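{- Let $r$ be a positive integer and let $w$ be a finite word over $\{0,1\}$. If $\widetilde w$ is the word obtained by reversing the order of the bits of $w$, then in $\mathbb{Z}[Y][[X]]$ $$R_{1,0}(w,r)=R_{0,1}(\widetilde w,r)\prod_{h=0}^{r-1}\frac1{1-XY^h}.$$
   Context: For $b,c\in\{0,1\}$ and a finite word $w$ over $\{0,1\}$, extend $w$ to a doubly infinite bit sequence $s:\mathbb{Z}\to\{0,1\}$ by adding infinitely many bits $b$ on its left and infinitely many bits $c$ on its right. A placement of $n$ $r$-ribbons (below the lattice path described by $s$: a unit step right for each bit $0$ and up for each bit $1$, read from left to right) is a sequence of positions $i_1<i_2<\cdots<i_n$ in $\mathbb{Z}$ such that one can successively, for $t=1,2,\dots,n$, perform the following change: the current bit sequence $s^{(t-1)}$ (with $s^{(0)}=s$) satisfies $s^{(t-1)}_{i_t-r}=1$ and $s^{(t-1)}_{i_t}=0$, and $s^{(t)}$ is obtained from it by setting the bit at $i_t-r$ to $0$ and the bit at $i_t$ to $1$. The height of the $t$-th ribbon is $\sum_{j=1}^{r-1}s^{(t-1)}_{i_t-j}$, and the total height of the placement is the sum of the heights of its $n$ ribbons. Then $$R_{b,c}(w,r)=\sum X^nY^{h},$$ the sum being over all placements of $r$-ribbons (all $n\ge0$, including the empty placement), where $n$ is the number of ribbons and $h$ the total height of the placement. (For each $n$ there are finitely many placements, so this is an element of $\mathbb{Z}[Y][[X]]$; for $(b,c)=(0,1)$ it is a polynomial.) -}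

module Defs where

open import Algebra.Bundles using (CommutativeRing; RawRing)
import Level
open import Algebra.Structures using (IsCommutativeRing)
import Algebra.Morphism.RingMonomorphism as RingMonomorphism
import Algebra.Properties.CommutativeMonoid.Sum as CommutativeMonoidSum
import Algebra.Properties.Ring as RingProperties
import Algebra.Properties.Semiring.Exp as SemiringExp
import Algebra.Properties.Semiring.Sum as SemiringSum
import Data.Integer.Properties as ℤₚ
import Data.Nat.Properties as ℕₚ
import Relation.Binary.Reasoning.Setoid as SetoidReasoning
open import Data.Empty using (⊥; ⊥-elim)
open import Data.Fin.Base using (Fin; zero; suc; toℕ)
open import Data.Fin.Patterns using (0F; 1F)
open import Data.Fin.Properties using () renaming (_≟_ to _≟ᵇ_)
open import Data.Integer.Base using (ℤ; +_; -[1+_]; _-_; _<_; +<+)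
open import Data.List.Base
  using (List; []; _∷_; length; map; foldr; filter; upTo; applyUpTo; cartesianProductWith)
open import Data.List.Membership.Propositional using (_∈_)
open import Data.List.Membership.Propositional.Properties
  using (∈-cartesianProductWith⁺; ∈-cartesianProductWith⁻; ∈-filter⁺; ∈-filter⁻; ∈-map⁺; ∈-upTo⁺)
open import Data.List.Properties using (∷-injective)
open import Data.List.Relation.Unary.All using (All; []; _∷_)
open import Data.List.Relation.Unary.AllPairs using ([]; _∷_)
open import Data.List.Relation.Unary.Any using (here)
open import Data.List.Relation.Unary.Linked using (Linked; []; [-]; _∷_; linked?)
open import Data.List.Relation.Unary.Unique.Propositional using (Unique)
import Data.List.Relation.Unary.Unique.Propositional.Properties as Uniqueₚ
open import Data.Nat.Base using (ℕ; zero; suc; _∸_; z≤n; s≤s)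
import Data.Nat.Base as ℕ
open import Data.Nat.ListAction using (sum)
open import Data.Product.Base using (_×_; _,_; proj₁; proj₂)
open import Data.Sum.Base using (_⊎_; inj₁; inj₂)
open import Data.Vec.Base using (Vec; []; _∷_; head; lookup)
open import Function.Base using (_∘_; _∋_)
open import Function.Bundles using (_⇔_; mk⇔)
open import Relation.Binary.PropositionalEquality as ≡ using (_≡_; _≢_; refl)
open import Relation.Nullary.Decidable using (Dec; yes; no; _×-dec_; map′)
open import Relation.Nullary.Negation using (contradiction)

------------------------------------------------------------------------
-- Formal power series over a commutative ring

module PowerSeries {c ℓ} (A : CommutativeRing c ℓ) where

  open CommutativeRing A
    hiding (zero; _-_; rawRing; isCommutativeRing)
    renaming (refl to ≈-refl; sym to ≈-sym; trans to ≈-trans)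
  open SemiringSum semiring using (∑-distrib-+; *-distribˡ-sum; sum-cong-≋; sum-replicate-zero; sum-syntax)
    renaming (sum to ∑)
  open SetoidReasoning setoid

  Series : Set c
  Series = ℕ → Carrier

  infix 4 _≈ₛ_

  -- A record, so that f and g can be inferred from a proof of f ≈ₛ g.
  record _≈ₛ_ (f g : Series) : Set ℓ where
    constructor coefficientwise
    field at : ∀ n → f n ≈ g n

  open _≈ₛ_ public

  0ₛ : Series
  0ₛ _ = 0#

  constant : Carrier → Series
  constant a zero    = a
  constant a (suc _) = 0#

  1ₛ : Series
  1ₛ = constant 1#

  X : Series
  X zero          = 0#
  X (suc zero)    = 1#
  X (suc (suc _)) = 0#

  infixl 6 _+ₛ_
  infixl 7 _*ₛ_

  _+ₛ_ : Series → Series → Series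
  (f +ₛ g) n = f n + g n

  -ₛ_ : Series → Series
  (-ₛ f) n = - f n

  _*ₛ_ : Series → Series → Series
  (f *ₛ g) n = ∑[ i < suc n ] (f (toℕ i) * g (n ∸ toℕ i))

  private
    *ₛ-cong : ∀ {f f′ g g′} → f ≈ₛ f′ → g ≈ₛ g′ → f *ₛ g ≈ₛ f′ *ₛ g′
    *ₛ-cong p q .at n = sum-cong-≋ λ (i : Fin (suc n)) → *-cong (p .at (toℕ i)) (q .at (n ∸ toℕ i))

    *ₛ-congʳ : ∀ {f f′ g} → f ≈ₛ f′ → f *ₛ g ≈ₛ f′ *ₛ g
    *ₛ-congʳ p = *ₛ-cong p (coefficientwise λ _ → ≈-refl)

    *ₛ-distribʳ : ∀ h f g → (f +ₛ g) *ₛ h ≈ₛ f *ₛ h +ₛ g *ₛ h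
    *ₛ-distribʳ h f g .at n = ≈-trans
      (sum-cong-≋ λ (i : Fin (suc n)) → distribʳ (h (n ∸ toℕ i)) (f (toℕ i)) (g (toℕ i)))
      (∑-distrib-+ {suc n} (λ i → f (toℕ i) * h (n ∸ toℕ i)) (λ i → g (toℕ i) * h (n ∸ toℕ i)))

    *ₛ-scale : ∀ a f g n → ((λ k → a * f k) *ₛ g) n ≈ a * (f *ₛ g) n
    *ₛ-scale a f g n = ≈-trans
      (sum-cong-≋ λ (i : Fin (suc n)) → *-assoc a (f (toℕ i)) (g (n ∸ toℕ i)))
      (≈-sym (*-distribˡ-sum {suc n} a (λ i → f (toℕ i) * g (n ∸ toℕ i))))

    *ₛ-assoc : ∀ f g h n → ((f *ₛ g) *ₛ h) n ≈ (f *ₛ (g *ₛ h)) n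
    *ₛ-assoc f g h zero = +-congʳ (begin
      (f 0 * g 0 + 0#) * h 0  ≈⟨ *-congʳ (+-identityʳ _) ⟩
      f 0 * g 0 * h 0         ≈⟨ *-assoc _ _ _ ⟩
      f 0 * (g 0 * h 0)       ≈⟨ *-congˡ (+-identityʳ _) ⟨
      f 0 * (g 0 * h 0 + 0#)  ∎)
    *ₛ-assoc f g h (suc n) = begin
      (f 0 * g 0 + 0#) * h (suc n) + (((λ k → f 0 * g (suc k)) +ₛ (f ∘ suc) *ₛ g) *ₛ h) n
        ≈⟨ +-cong (≈-trans (*-congʳ (+-identityʳ _)) (*-assoc _ _ _))
                  (*ₛ-distribʳ h (λ k → f 0 * g (suc k)) ((f ∘ suc) *ₛ g) .at n) ⟩
      f 0 * (g 0 * h (suc n)) + (((λ k → f 0 * g (suc k)) *ₛ h) n + (((f ∘ suc) *ₛ g) *ₛ h) n)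
        ≈⟨ +-congˡ (+-cong (*ₛ-scale (f 0) (g ∘ suc) h n) (*ₛ-assoc (f ∘ suc) g h n)) ⟩
      f 0 * (g 0 * h (suc n)) + (f 0 * ((g ∘ suc) *ₛ h) n + ((f ∘ suc) *ₛ (g *ₛ h)) n)
        ≈⟨ +-assoc _ _ _ ⟨
      f 0 * (g 0 * h (suc n)) + f 0 * ((g ∘ suc) *ₛ h) n + ((f ∘ suc) *ₛ (g *ₛ h)) n
        ≈⟨ +-congʳ (distribˡ _ _ _) ⟨
      f 0 * (g 0 * h (suc n) + ((g ∘ suc) *ₛ h) n) + ((f ∘ suc) *ₛ (g *ₛ h)) n ∎

    *ₛ-suc : ∀ f g n → (f *ₛ g) (suc n) ≈ (f *ₛ (g ∘ suc)) n + f (suc n) * g 0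
    *ₛ-suc f g zero    = ≈-trans (≈-sym (+-assoc _ _ _)) (≈-trans (+-identityʳ _) (+-congʳ (≈-sym (+-identityʳ _))))
    *ₛ-suc f g (suc n) = ≈-trans (+-congˡ (*ₛ-suc (f ∘ suc) g n)) (≈-sym (+-assoc _ _ _))

    *ₛ-comm : ∀ f g n → (f *ₛ g) n ≈ (g *ₛ f) n
    *ₛ-comm f g zero    = +-congʳ (*-comm _ _)
    *ₛ-comm f g (suc n) = begin
      f 0 * g (suc n) + ((f ∘ suc) *ₛ g) n  ≈⟨ +-cong (*-comm _ _) (*ₛ-comm (f ∘ suc) g n) ⟩
      g (suc n) * f 0 + (g *ₛ (f ∘ suc)) n  ≈⟨ +-comm _ _ ⟩
      (g *ₛ (f ∘ suc)) n + g (suc n) * f 0  ≈⟨ *ₛ-suc g f n ⟨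
      (g *ₛ f) (suc n)                      ∎

    *ₛ-zeroˡ : ∀ f n → (0ₛ *ₛ f) n ≈ 0#
    *ₛ-zeroˡ f n = ≈-trans (sum-cong-≋ λ (i : Fin (suc n)) → zeroˡ (f (n ∸ toℕ i))) (sum-replicate-zero (suc n))

    *ₛ-identityˡ : ∀ f n → (1ₛ *ₛ f) n ≈ f n
    *ₛ-identityˡ f zero    = ≈-trans (+-identityʳ _) (*-identityˡ _)
    *ₛ-identityˡ f (suc n) = ≈-trans (+-cong (*-identityˡ _) (*ₛ-zeroˡ f n)) (+-identityʳ _)

  isCommutativeRing : IsCommutativeRing _≈ₛ_ _+ₛ_ _*ₛ_ -ₛ_ 0ₛ 1ₛ
  isCommutativeRing = record
    { isRing = record
      { +-isAbelianGroup = record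
        { isGroup = record
          { isMonoid = record
            { isSemigroup = record
              { isMagma = record
                { isEquivalence = record
                  { refl  = coefficientwise λ _ → ≈-refl
                  ; sym   = λ p → coefficientwise λ n → ≈-sym (p .at n)
                  ; trans = λ p q → coefficientwise λ n → ≈-trans (p .at n) (q .at n)
                  }
                ; ∙-cong = λ p q → coefficientwise λ n → +-cong (p .at n) (q .at n)
                }
              ; assoc = λ f g h → coefficientwise λ n → +-assoc (f n) (g n) (h n)
              }
            ; identity = (λ f → coefficientwise λ n → +-identityˡ (f n))
                       , (λ f → coefficientwise λ n → +-identityʳ (f n))
            }
          ; inverse = (λ f → coefficientwise λ n → -‿inverseˡ (f n))
                    , (λ f → coefficientwise λ n → -‿inverseʳ (f n))
          ; ⁻¹-cong = λ p → coefficientwise λ n → -‿cong (p .at n)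
          }
        ; comm = λ f g → coefficientwise λ n → +-comm (f n) (g n)
        }
      ; *-cong     = *ₛ-cong
      ; *-assoc    = λ f g h → coefficientwise (*ₛ-assoc f g h)
      ; *-identity = (λ f → coefficientwise (*ₛ-identityˡ f))
                   , (λ f → coefficientwise λ n → ≈-trans (*ₛ-comm f 1ₛ n) (*ₛ-identityˡ f n))
      ; distrib    = (λ h f g → coefficientwise λ n → begin
                        (h *ₛ (f +ₛ g)) n         ≈⟨ *ₛ-comm h (f +ₛ g) n ⟩
                        ((f +ₛ g) *ₛ h) n         ≈⟨ *ₛ-distribʳ h f g .at n ⟩
                        (f *ₛ h) n + (g *ₛ h) n   ≈⟨ +-cong (*ₛ-comm f h n) (*ₛ-comm g h n) ⟩
                        (h *ₛ f) n + (h *ₛ g) n   ∎)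
                   , *ₛ-distribʳ
      }
    ; *-comm = λ f g → coefficientwise (*ₛ-comm f g)
    }

  commutativeRing : CommutativeRing c ℓ
  commutativeRing = record { isCommutativeRing = isCommutativeRing }

  -- The inverse of a series f with constant term 1:  g₀ = 1  and
  -- gₙ₊₁ = - Σ_{k≤n} fₖ₊₁ gₙ₋ₖ.  (For other f the value is junk.)
  -- inverseCoefficients f n lists gₙ, …, g₀ in this order.

  inverseCoefficients : Series → (n : ℕ) → Vec Carrier (suc n)
  inverseCoefficients f zero    = 1# ∷ []
  inverseCoefficients f (suc n) =
    - (∑[ k < suc n ] (f (suc (toℕ k)) * lookup (inverseCoefficients f n) k)) ∷ inverseCoefficients f n

  infix 8 _⁻¹

  _⁻¹ : Series → Series
  (f ⁻¹) n = head (inverseCoefficients f n)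

  private
    lookup-inverseCoefficients : ∀ f n (k : Fin (suc n)) →
      lookup (inverseCoefficients f n) k ≡ (f ⁻¹) (n ∸ toℕ k)
    lookup-inverseCoefficients f zero    zero    = refl
    lookup-inverseCoefficients f (suc n) zero    = refl
    lookup-inverseCoefficients f (suc n) (suc k) = lookup-inverseCoefficients f n k

  ⁻¹-inverseʳ : ∀ f → f 0 ≈ 1# → f *ₛ f ⁻¹ ≈ₛ 1ₛ
  ⁻¹-inverseʳ f f₀≈1 .at zero    = ≈-trans (+-identityʳ _) (≈-trans (*-identityʳ _) f₀≈1)
  ⁻¹-inverseʳ f f₀≈1 .at (suc n) = begin
    f 0 * - S + ((f ∘ suc) *ₛ f ⁻¹) n  ≈⟨ +-cong (≈-trans (*-congʳ f₀≈1) (*-identityˡ _)) (≈-sym S≈) ⟩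
    - S + S                            ≈⟨ -‿inverseˡ S ⟩
    0#                                 ∎
    where
    S = ∑[ k < suc n ] (f (suc (toℕ k)) * lookup (inverseCoefficients f n) k)
    S≈ : S ≈ ((f ∘ suc) *ₛ f ⁻¹) n
    S≈ = sum-cong-≋ λ k → *-congˡ {f (suc (toℕ k))} (reflexive (lookup-inverseCoefficients f n k))

------------------------------------------------------------------------
-- Polynomials, as the power series with finitely many nonzero terms

module Polynomials {c ℓ} (A : CommutativeRing c ℓ) where

  open CommutativeRing A
    hiding (zero; _-_; rawRing; isCommutativeRing)
    renaming (refl to ≈-refl; sym to ≈-sym; trans to ≈-trans)
  open RingProperties ring using (-0#≈0#)
  open SemiringSum semiring using (sum-cong-≋; sum-replicate-zero)
  private module S = PowerSeries A
  open S using (Series; _≈ₛ_; 0ₛ; 1ₛ; _+ₛ_; _*ₛ_; -ₛ_)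

  record Polynomial : Set (c Level.⊔ ℓ) where
    field
      coefficient : Series
      bound       : ℕ
      vanishes    : ∀ {k} → bound ℕ.≤ k → coefficient k ≈ 0#

  open Polynomial public

  infix 4 _≈ₚ_

  record _≈ₚ_ (p q : Polynomial) : Set ℓ where
    constructor coefficientwise
    field series : coefficient p ≈ₛ coefficient q

  open _≈ₚ_ public

  0ₚ : Polynomial
  0ₚ = record { coefficient = 0ₛ ; bound = 0 ; vanishes = λ _ → ≈-refl }

  1ₚ : Polynomial
  1ₚ = record { coefficient = 1ₛ ; bound = 1 ; vanishes = λ { (s≤s _) → ≈-refl } }

  variableₚ : Polynomial
  variableₚ = record { coefficient = S.X ; bound = 2 ; vanishes = λ { (s≤s (s≤s _)) → ≈-refl } }

  _+ₚ_ : Polynomial → Polynomial → Polynomial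
  p +ₚ q = record
    { coefficient = coefficient p +ₛ coefficient q
    ; bound       = bound p ℕ.⊔ bound q
    ; vanishes    = λ b≤k → ≈-trans
        (+-cong (vanishes p (ℕₚ.m⊔n≤o⇒m≤o (bound p) (bound q) b≤k))
                (vanishes q (ℕₚ.m⊔n≤o⇒n≤o (bound p) (bound q) b≤k)))
        (+-identityˡ 0#)
    }

  -ₚ_ : Polynomial → Polynomial
  -ₚ p = record
    { coefficient = -ₛ coefficient p
    ; bound       = bound p
    ; vanishes    = λ b≤k → ≈-trans (-‿cong (vanishes p b≤k)) -0#≈0#
    }

  private
    split : ∀ m n i k → m ℕ.+ n ℕ.≤ k → m ℕ.≤ i ⊎ n ℕ.≤ k ∸ i
    split m n i k m+n≤k with ℕₚ.≤-total m i
    ... | inj₁ m≤i = inj₁ m≤i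
    ... | inj₂ i≤m = inj₂ (ℕₚ.m+n≤o⇒m≤o∸n n (≡.subst (ℕ._≤ k) (ℕₚ.+-comm i n) (ℕₚ.≤-trans (ℕₚ.+-monoˡ-≤ n i≤m) m+n≤k)))

  _*ₚ_ : Polynomial → Polynomial → Polynomial
  p *ₚ q = record
    { coefficient = coefficient p *ₛ coefficient q
    ; bound       = bound p ℕ.+ bound q
    ; vanishes    = λ {k} b≤k → ≈-trans
        (sum-cong-≋ λ (i : Fin (suc k)) → term k b≤k (toℕ i))
        (sum-replicate-zero (suc k))
    }
    where
    term : ∀ k → bound p ℕ.+ bound q ℕ.≤ k → ∀ i → coefficient p i * coefficient q (k ∸ i) ≈ 0#
    term k b≤k i with split (bound p) (bound q) i k b≤k
    ... | inj₁ b≤i   = ≈-trans (*-congʳ (vanishes p b≤i)) (zeroˡ _)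
    ... | inj₂ b≤k∸i = ≈-trans (*-congˡ (vanishes q b≤k∸i)) (zeroʳ _)

  rawRing : RawRing (c Level.⊔ ℓ) ℓ
  rawRing = record { _≈_ = _≈ₚ_ ; _+_ = _+ₚ_ ; _*_ = _*ₚ_ ; -_ = -ₚ_ ; 0# = 0ₚ ; 1# = 1ₚ }

  commutativeRing : CommutativeRing (c Level.⊔ ℓ) ℓ
  commutativeRing = record
    { isCommutativeRing = RingMonomorphism.isCommutativeRing
        {R₁ = rawRing} {R₂ = CommutativeRing.rawRing S.commutativeRing} {⟦_⟧ = coefficient}
        (record
          { isRingHomomorphism = record
            { isSemiringHomomorphism = record
              { isNearSemiringHomomorphism = record
                { +-isMonoidHomomorphism = record
                  { isMagmaHomomorphism = record
                    { isRelHomomorphism = record { cong = series }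
                    ; homo              = λ _ _ → ≈ₛ-refl
                    }
                  ; ε-homo = ≈ₛ-refl
                  }
                ; *-homo = λ _ _ → ≈ₛ-refl
                }
              ; 1#-homo = ≈ₛ-refl
              }
            ; -‿homo = λ _ → ≈ₛ-refl
            }
          ; injective = coefficientwise
          })
        S.isCommutativeRing
    }
    where
    ≈ₛ-refl : ∀ {f} → f ≈ₛ f
    ≈ₛ-refl = CommutativeRing.refl S.commutativeRing

------------------------------------------------------------------------
-- ℤ[Y] and ℤ[Y][[X]]

ℤ[Y] : CommutativeRing _ _
ℤ[Y] = Polynomials.commutativeRing ℤₚ.+-*-commutativeRing

ℤ[Y][[X]] : CommutativeRing _ _
ℤ[Y][[X]] = PowerSeries.commutativeRing ℤ[Y]

Y : CommutativeRing.Carrier ℤ[Y]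
Y = Polynomials.variableₚ ℤₚ.+-*-commutativeRing

open SemiringExp (CommutativeRing.semiring ℤ[Y]) public using (_^_)

open PowerSeries ℤ[Y] public using (X; constant; _⁻¹; ⁻¹-inverseʳ)

open CommutativeMonoidSum (CommutativeRing.*-commutativeMonoid ℤ[Y][[X]]) public using ()
  renaming (sum to ∏)

------------------------------------------------------------------------
-- Ribbon placements

Bit : Set
Bit = Fin 2

BitSequence : Set
BitSequence = ℤ → Bit

-- The bits of w occupy the positions 0, …, length w - 1.

extend : Bit → Bit → List Bit → BitSequence
extend b c w       -[1+ _ ]  = b
extend b c []      (+ _)     = c
extend b c (x ∷ w) (+ zero)  = x
extend b c (x ∷ w) (+ suc k) = extend b c w (+ k)

module Ribbons (r : ℕ) where

  Addable : BitSequence → ℤ → Set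
  Addable s i = s (i - + r) ≡ 1F × s i ≡ 0F

  add : ℤ → BitSequence → BitSequence
  add i s j with j ℤₚ.≟ i - + r | j ℤₚ.≟ i
  ... | yes _ | _     = 0F
  ... | no _  | yes _ = 1F
  ... | no _  | no _  = s j

  height : BitSequence → ℤ → ℕ
  height s i = sum (applyUpTo (λ j → toℕ (s (i - + suc j))) (r ∸ 1))

  data SuccessivelyAddable : BitSequence → List ℤ → Set where
    []  : ∀ {s} → SuccessivelyAddable s []
    _∷_ : ∀ {s i is} → Addable s i → SuccessivelyAddable (add i s) is →
          SuccessivelyAddable s (i ∷ is)

  IsPlacement : BitSequence → List ℤ → Set
  IsPlacement s is = Linked _<_ is × SuccessivelyAddable s is

  totalHeight : BitSequence → List ℤ → ℕ
  totalHeight s []       = 0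
  totalHeight s (i ∷ is) = height s i ℕ.+ totalHeight (add i s) is

  successivelyAddable? : ∀ s is → Dec (SuccessivelyAddable s is)
  successivelyAddable? s []       = yes []
  successivelyAddable? s (i ∷ is) = map′ (λ (p , q) → p ∷ q) (λ { (p ∷ q) → p , q })
    ((s (i - + r) ≟ᵇ 1F ×-dec s i ≟ᵇ 0F) ×-dec successivelyAddable? (add i s) is)

  isPlacement? : ∀ s is → Dec (IsPlacement s is)
  isPlacement? s is = linked? ℤₚ._<?_ is ×-dec successivelyAddable? s is

  sequences : ℕ → List ℤ → List (List ℤ)
  sequences zero    xs = [] ∷ []
  sequences (suc n) xs = cartesianProductWith _∷_ xs (sequences n xs)

  -- All placements of n ribbons; see ∈-placements and placements-unique.
  -- The window is large enough because n ribbons can be placed only at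
  -- positions i with 0 ≤ i < length w + n r.

  placements : Bit → Bit → List Bit → ℕ → List (List ℤ)
  placements b c w n =
    filter (isPlacement? (extend b c w)) (sequences n (map +_ (upTo (n ℕ.* r ℕ.+ length w))))

  private
    ∈-sequences⁺ : ∀ {xs} is → All (_∈ xs) is → is ∈ sequences (length is) xs
    ∈-sequences⁺ []       []       = here refl
    ∈-sequences⁺ (i ∷ is) (p ∷ ps) = ∈-cartesianProductWith⁺ _∷_ p (∈-sequences⁺ is ps)

    ∈-sequences⁻ : ∀ n {xs is} → is ∈ sequences n xs → length is ≡ n
    ∈-sequences⁻ zero         (here refl) = refl
    ∈-sequences⁻ (suc n) {xs} p with ∈-cartesianProductWith⁻ _∷_ xs (sequences n xs) p
    ... | _ , _ , _ , q , refl = ≡.cong suc (∈-sequences⁻ n q)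

    sequences-unique : ∀ n {xs} → Unique xs → Unique (sequences n xs)
    sequences-unique zero    u = [] ∷ []
    sequences-unique (suc n) u = Uniqueₚ.cartesianProductWith⁺ _∷_ ∷-injective u (sequences-unique n u)

    extend-right : ∀ b c w k → length w ℕ.≤ k → extend b c w (+ k) ≡ c
    extend-right b c []      k       _       = refl
    extend-right b c (_ ∷ w) (suc k) (s≤s p) = extend-right b c w k p

    0≢1 : 0F ≢ (Bit ∋ 1F)
    0≢1 ()

    ¬negative : ∀ b c w k → Addable (extend b c w) -[1+ k ] → ⊥
    ¬negative b c w k (p , q) = 0≢1 (≡.trans (≡.sym q) (≡.trans (≡.sym (left r)) p))
      where
      left : ∀ m → extend b c w (-[1+ k ] - + m) ≡ b
      left zero    = refl
      left (suc _) = refl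

    add-outside : ∀ {s i j} → j ≢ i - + r → j ≢ i → add i s j ≡ s j
    add-outside {s} {i} {j} p q with j ℤₚ.≟ i - + r | j ℤₚ.≟ i
    ... | yes e | _     = contradiction e p
    ... | no _  | yes e = contradiction e q
    ... | no _  | no _  = refl

    ConstantFrom : Bit → ℕ → BitSequence → Set
    ConstantFrom c m s = ∀ k → m ℕ.≤ k → s (+ k) ≡ c

    addable-bound : ∀ {c m s} k → ConstantFrom c m s → Addable s (+ k) → k ℕ.< r ℕ.+ m
    addable-bound {c} {m} {s} k const (p , q) with k ℕₚ.<? r ℕ.+ m
    ... | yes k< = k<
    ... | no k≮  = contradiction 0≡1 0≢1
      where
      r+m≤k : r ℕ.+ m ℕ.≤ k
      r+m≤k = ℕₚ.≮⇒≥ k≮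
      k-r : + k - + r ≡ + (k ∸ r)
      k-r = ≡.trans (ℤₚ.m-n≡m⊖n k r) (ℤₚ.⊖-≥ (ℕₚ.m+n≤o⇒m≤o r r+m≤k))
      0≡1 : 0F ≡ 1F
      0≡1 = ≡.trans (≡.sym q) (≡.trans (const k (ℕₚ.m+n≤o⇒n≤o r r+m≤k))
        (≡.trans (≡.sym (const (k ∸ r) (ℕₚ.m+n≤o⇒m≤o∸n m (≡.subst (ℕ._≤ k) (ℕₚ.+-comm r m) r+m≤k))))
          (≡.trans (≡.cong s (≡.sym k-r)) p)))

    add-constant : ∀ {c m s} k → k ℕ.< r ℕ.+ m → ConstantFrom c m s → ConstantFrom c (r ℕ.+ m) (add (+ k) s)
    add-constant {m = m} k k< const l r+m≤l = ≡.trans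
      (add-outside
        (λ e → ℤₚ.<⇒≢ (ℤₚ.≤-<-trans (ℤₚ.i-j≤i (+ k) (+ r)) (+<+ k<l)) (≡.sym e))
        (λ e → ℕₚ.<⇒≢ k<l (≡.sym (ℤₚ.+-injective e))))
      (const l (ℕₚ.m+n≤o⇒n≤o r r+m≤l))
      where
      k<l : k ℕ.< l
      k<l = ℕₚ.<-≤-trans k< r+m≤l

    InWindow : ℕ → ℤ → Set
    InWindow m i = i ∈ map +_ (upTo m)

    inWindow : ∀ {m k} → k ℕ.< m → InWindow m (+ k)
    inWindow k< = ∈-map⁺ +_ (∈-upTo⁺ k<)

    bounded : ∀ {c m s} k is → ConstantFrom c m s → IsPlacement s (+ k ∷ is) →
              All (InWindow (length (+ k ∷ is) ℕ.* r ℕ.+ m)) (+ k ∷ is)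
    bounded {m = m} {s = s} k [] const (_ , p ∷ _) =
      inWindow (≡.subst (λ x → k ℕ.< x ℕ.+ m) (≡.sym (ℕₚ.+-identityʳ r)) (addable-bound {s = s} k const p)) ∷ []
    bounded {m = m} {s = s} k is@(+ l ∷ is′) const (_ ∷ lk , p ∷ ps) =
      inWindow (ℕₚ.<-≤-trans k< (ℕₚ.+-monoˡ-≤ m (ℕₚ.m≤m+n r _))) ∷
      ≡.subst (λ x → All (InWindow x) is) shift
        (bounded {s = add (+ k) s} l is′ (add-constant {s = s} k k< const) (lk , ps))
      where
      k< = addable-bound {s = s} k const p
      shift : length is ℕ.* r ℕ.+ (r ℕ.+ m) ≡ r ℕ.+ length is ℕ.* r ℕ.+ m
      shift = ≡.trans (≡.sym (ℕₚ.+-assoc (length is ℕ.* r) r m))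
                      (≡.cong (ℕ._+ m) (ℕₚ.+-comm (length is ℕ.* r) r))

    placement-bounded : ∀ b c w is → IsPlacement (extend b c w) is →
                        All (InWindow (length is ℕ.* r ℕ.+ length w)) is
    placement-bounded b c w []              _           = []
    placement-bounded b c w (-[1+ k ] ∷ _)  (_ , p ∷ _) = ⊥-elim (¬negative b c w k p)
    placement-bounded b c w (+ k ∷ is)      p           = bounded {s = extend b c w} k is (extend-right b c w) p

  ∈-placements : ∀ b c w n is →
    is ∈ placements b c w n ⇔ (length is ≡ n × IsPlacement (extend b c w) is)
  ∈-placements b c w n is = mk⇔
    (λ p → let q , pl = ∈-filter⁻ (isPlacement? (extend b c w)) p in ∈-sequences⁻ n q , pl)
    (λ { (refl , pl) → ∈-filter⁺ (isPlacement? (extend b c w))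
                         (∈-sequences⁺ is (placement-bounded b c w is pl)) pl })

  placements-unique : ∀ b c w n → Unique (placements b c w n)
  placements-unique b c w n = Uniqueₚ.filter⁺ (isPlacement? (extend b c w))
    (sequences-unique n (Uniqueₚ.map⁺ ℤₚ.+-injective (Uniqueₚ.upTo⁺ _)))

open Ribbons using (placements; totalHeight)

R : Bit → Bit → List Bit → ℕ → CommutativeRing.Carrier ℤ[Y][[X]]
R b c w r n = foldr _+_ 0# (map (λ is → Y ^ totalHeight r (extend b c w) is) (placements r b c w n))
  where open CommutativeRing ℤ[Y] using (_+_; 0#)

{-# OPTIONS --safe #-}

-- Scan the positions from left to right, remembering only the r bits before
-- the current position (the window a); adding a ribbon multiplies the weight
-- by wt h = X Y^h, where h is the number of ones in the window after its first
-- bit.  Thus R_{b,c}(w,r) is a sum over the paths of a finite automaton which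
-- starts in the window b^r and reads w c^∞.  Reading further ones allows no
-- ribbon.  Reading further zeros rotates a window with k ones until it is empty
-- and contributes f k = ∏_{h<k} 1/(1 - X Y^h), the solution of
-- f (k+1) = f k + wt k · f (k+1).  Hence
--     R_{0,1}(w,r) = V (0^r) w   and   R_{1,0}(w,r) = L (1^r) w,
-- where V weights the final windows by 1 and L weights them by f.
--
-- Peeling bits off the right end of the word read by L gives the transition
-- rule of V read backwards:  for u of length r - 1 with |u| ones and bits x, y,
--     L a (y u x) = L a (y u) + [x = 1, y = 0] wt |u| · L a (1 u).
-- So L (1^r) (q̃ b̃) = f r · V b q for windows b, by induction on q; take b = 0^r.

module Submission where

open import Defs
open import Algebra.Bundles using (CommutativeRing)
open import Data.Fin.Base using (Fin; toℕ)
open import Data.Fin.Patterns using (0F; 1F)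
open import Data.List.Base using (List; reverse)
open import Data.Nat.Base using (ℕ; NonZero)
import Algebra.Properties.CommutativeMonoid.Sum as CommutativeMonoidSum
import Algebra.Properties.CommutativeSemigroup as CommutativeSemigroupProperties
import Algebra.Properties.Ring as RingProperties
import Algebra.Properties.Semiring.Exp as SemiringExp
import Algebra.Properties.Semiring.Sum as SemiringSum
import Algebra.Solver.Ring.NaturalCoefficients.Default as SemiringSolver
open import Data.Empty using (⊥)
open import Data.Fin.Properties using (toℕ-inject₁; toℕ-fromℕ) renaming (_≟_ to _≟ᵇ_)
open import Data.Integer.Base using (ℤ; +_)
import Data.Integer.Base as ℤ
import Data.Integer.Properties as ℤₚ
open import Data.Integer.Solver using (module +-*-Solver)
open import Data.List.Base
  using ([]; _∷_; [_]; _++_; _∷ʳ_; length; map; foldr; replicate; applyUpTo; upTo)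
open import Data.List.Membership.Propositional using (_∈_)
open import Data.List.Membership.Propositional.Properties
  using (∈-map⁺; ∈-map⁻; ∈-++⁺ˡ; ∈-++⁺ʳ; ∈-++⁻; ∈-filter⁻; ∈-upTo⁻; ∈-cartesianProductWith⁻)
open import Data.List.Membership.Propositional.Properties.WithK using (unique∧set⇒bag)
open import Data.List.Properties
  using ( unfold-reverse; reverse-++; reverse-involutive; ∷ʳ-++; length-++; length-replicate
        ; length-reverse; ++-assoc; ++-identityʳ; applyUpTo-∷ʳ; ∷-injectiveʳ)
open import Data.List.Relation.Binary.BagAndSetEquality using (∼bag⇒↭)
open import Data.List.Relation.Binary.Disjoint.Propositional using (Disjoint)
open import Data.List.Relation.Binary.Permutation.Propositional using (_↭_; ↭⇒↭ₛ′)
import Data.List.Relation.Binary.Permutation.Propositional.Properties as ↭ₚ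
open import Data.List.Relation.Binary.Permutation.Setoid.Properties using (foldr-commMonoid)
open import Data.List.Relation.Unary.All as All using (All; []; _∷_)
open import Data.List.Relation.Unary.AllPairs as AllPairs using ([]; _∷_)
open import Data.List.Relation.Unary.Any using (here)
open import Data.List.Relation.Unary.Linked as Linked using (Linked; []; [-]; _∷_)
open import Data.List.Relation.Unary.Linked.Properties using (Linked⇒All; Linked⇒AllPairs)
open import Data.List.Relation.Unary.Unique.Propositional using (Unique)
import Data.List.Relation.Unary.Unique.Propositional.Properties as Uniqueₚ
open import Data.Nat.Base using (zero; suc; s≤s; z≤n)
import Data.Nat.Base as ℕ
open import Data.Nat.ListAction using (sum)
open import Data.Nat.ListAction.Properties using (sum-++)
import Data.Nat.Properties as ℕₚ
open import Data.Product.Base using (_×_; _,_; proj₁; proj₂; ∃-syntax)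
open import Data.Sum.Base using (inj₁; inj₂)
open import Function.Base using (_∘_; const)
open import Function.Bundles using (Equivalence; mk⇔)
import Relation.Binary.Reasoning.Setoid as SetoidReasoning
open import Relation.Binary.PropositionalEquality as ≡ using (_≡_; _≢_)
open import Relation.Nullary.Decidable using (Dec; yes; no; _×-dec_)
open import Relation.Nullary.Negation using (contradiction)

-- Words over the two bits: numbers of ones, lengths, constant words, reversal.

ones : List Bit → ℕ
ones = sum ∘ map toℕ

ones-++ : ∀ a b → ones (a ++ b) ≡ ones a ℕ.+ ones b
ones-++ []      b = ≡.refl
ones-++ (x ∷ a) b = ≡.trans (≡.cong (toℕ x ℕ.+_) (ones-++ a b)) (≡.sym (ℕₚ.+-assoc (toℕ x) (ones a) (ones b)))

ones-∷ʳ : ∀ a x → ones (a ∷ʳ x) ≡ toℕ x ℕ.+ ones a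
ones-∷ʳ a x = ≡.trans (ones-++ a [ x ])
  (≡.trans (≡.cong (ones a ℕ.+_) (ℕₚ.+-identityʳ (toℕ x))) (ℕₚ.+-comm (ones a) (toℕ x)))

ones-reverse : ∀ a → ones (reverse a) ≡ ones a
ones-reverse []      = ≡.refl
ones-reverse (x ∷ a) = ≡.trans (≡.cong ones (unfold-reverse x a))
  (≡.trans (ones-∷ʳ (reverse a) x) (≡.cong (toℕ x ℕ.+_) (ones-reverse a)))

ones-replicate : ∀ k → ones (replicate k 1F) ≡ k
ones-replicate zero    = ≡.refl
ones-replicate (suc k) = ≡.cong suc (ones-replicate k)

ones-0s : ∀ k → ones (replicate k 0F) ≡ 0
ones-0s zero    = ≡.refl
ones-0s (suc k) = ones-0s k

length-∷ʳ : ∀ {ℓ} {A : Set ℓ} (a : List A) x → length (a ∷ʳ x) ≡ suc (length a)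
length-∷ʳ a x = ≡.trans (length-++ a) (ℕₚ.+-comm (length a) 1)

replicate-++ : ∀ {ℓ} {A : Set ℓ} m n {x : A} → replicate (m ℕ.+ n) x ≡ replicate m x ++ replicate n x
replicate-++ zero    n     = ≡.refl
replicate-++ (suc m) n {x} = ≡.cong (x ∷_) (replicate-++ m n)

replicate-∷ʳ : ∀ {ℓ} {A : Set ℓ} n {x : A} → replicate n x ∷ʳ x ≡ replicate (suc n) x
replicate-∷ʳ zero        = ≡.refl
replicate-∷ʳ (suc n) {x} = ≡.cong (x ∷_) (replicate-∷ʳ n)

reverse-replicate : ∀ {ℓ} {A : Set ℓ} n {x : A} → reverse (replicate n x) ≡ replicate n x
reverse-replicate zero        = ≡.refl
reverse-replicate (suc n) {x} = ≡.trans (unfold-reverse x (replicate n x))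
  (≡.trans (≡.cong (_∷ʳ x) (reverse-replicate n)) (replicate-∷ʳ n))

-- The window automaton over an arbitrary commutative ring.

module Transfer {c ℓ} (A : CommutativeRing c ℓ) (wt : ℕ → CommutativeRing.Carrier A) where

  open CommutativeRing A hiding (zero)
  open SemiringSolver commutativeSemiring using (solve; _:+_; _:*_; _:=_)
  open SetoidReasoning setoid

  -- A forbidden ribbon gets weight `0#`, so that the transition rule of `transfer` is one formula
  -- for all pairs of bits.
  jump : Bit → Bit → ℕ → Carrier
  jump 1F 0F k = wt k
  jump 1F 1F k = 0#
  jump 0F _  k = 0#

  -- The window a holds the r bits before the unread word u; a ribbon at the
  -- first position of u moves a 1 there from the first position of a.
  transfer : (List Bit → Carrier) → List Bit → List Bit → Carrier
  -- A default value: the windows of the theorem have positive length.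
  transfer g []      u       = g []
  transfer g (b ∷ a) []      = g (b ∷ a)
  transfer g (b ∷ a) (x ∷ u) =
    transfer g (a ∷ʳ x) u + jump b x (ones a) * transfer g (a ∷ʳ 1F) u

  transfer-[] : ∀ g a → transfer g a [] ≡ g a
  transfer-[] g []      = ≡.refl
  transfer-[] g (b ∷ a) = ≡.refl

  jump-1F : ∀ b k → jump b 1F k ≡ 0#
  jump-1F 0F k = ≡.refl
  jump-1F 1F k = ≡.refl

  *-vanishesˡ : ∀ {p} q → p ≡ 0# → p * q ≈ 0#
  *-vanishesˡ q ≡.refl = zeroˡ q

  +-*-vanishes : ∀ {p q e} → p ≡ 0# → e + p * q ≈ e
  +-*-vanishes {q = q} {e} p≡0 = trans (+-congˡ (*-vanishesˡ q p≡0)) (+-identityʳ e)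

  path-count : List Bit → List Bit → Carrier
  path-count = transfer (const 1#)

  -- Used to split off trailing zeros: reading them becomes the final weight of the windows reached
  -- after `u`.
  transfer-++ : ∀ g a u v → transfer g a (u ++ v) ≡ transfer (λ b → transfer g b v) a u
  transfer-++ g []      u       v = ≡.refl
  transfer-++ g (b ∷ a) []      v = ≡.refl
  transfer-++ g (b ∷ a) (x ∷ u) v = ≡.cong₂ (λ s t → s + jump b x (ones a) * t)
    (transfer-++ g (a ∷ʳ x) u v) (transfer-++ g (a ∷ʳ 1F) u v)

  path-count-1s : ∀ k a → path-count a (replicate k 1F) ≈ 1#
  path-count-1s k       []      = refl
  path-count-1s zero    (b ∷ a) = refl
  path-count-1s (suc k) (b ∷ a) = trans (+-*-vanishes (jump-1F b (ones a))) (path-count-1s k (a ∷ʳ 1F))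

  path-count-++-1s : ∀ u k a → path-count a (u ++ replicate k 1F) ≈ path-count a u
  path-count-++-1s u       k []      = refl
  path-count-++-1s []      k (b ∷ a) = path-count-1s k (b ∷ a)
  path-count-++-1s (x ∷ u) k (b ∷ a) =
    +-cong (path-count-++-1s u k (a ∷ʳ x)) (*-congˡ (path-count-++-1s u k (a ∷ʳ 1F)))

  path-count-0s : ∀ k j → path-count (replicate j 0F) (replicate k 0F) ≈ 1#
  path-count-0s k       zero    = refl
  path-count-0s zero    (suc j) = refl
  path-count-0s (suc k) (suc j) = trans (+-*-vanishes ≡.refl)
    (trans (reflexive (≡.cong (λ a → path-count a (replicate k 0F)) (replicate-∷ʳ j))) (path-count-0s k (suc j)))

  -- Each transition is linear in the values of the windows it reaches and keeps their length, so a
  -- linear relation between three suffixes survives any common prefix.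
  transfer-++-combination : ∀ g n k {u₁ u₂ u₃} →
    (∀ a → length a ≡ n → transfer g a u₁ ≈ transfer g a u₂ + k * transfer g a u₃) →
    ∀ p a → length a ≡ n → transfer g a (p ++ u₁) ≈ transfer g a (p ++ u₂) + k * transfer g a (p ++ u₃)
  transfer-++-combination g n k h []      a       len = h a len
  transfer-++-combination g n k h (x ∷ p) []      len = h [] len
  transfer-++-combination g n k {u₁} {u₂} {u₃} h (x ∷ p) (b ∷ a) len = begin
    t₁ (a ∷ʳ x) + j * t₁ (a ∷ʳ 1F)
      ≈⟨ +-cong (ih x) (*-congˡ (ih 1F)) ⟩
    (t₂ (a ∷ʳ x) + k * t₃ (a ∷ʳ x)) + j * (t₂ (a ∷ʳ 1F) + k * t₃ (a ∷ʳ 1F))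
      ≈⟨ solve 6 (λ s s′ t t′ j k → (s :+ k :* t) :+ j :* (s′ :+ k :* t′) := (s :+ j :* s′) :+ k :* (t :+ j :* t′)) refl
           (t₂ (a ∷ʳ x)) (t₂ (a ∷ʳ 1F)) (t₃ (a ∷ʳ x)) (t₃ (a ∷ʳ 1F)) j k ⟩
    (t₂ (a ∷ʳ x) + j * t₂ (a ∷ʳ 1F)) + k * (t₃ (a ∷ʳ x) + j * t₃ (a ∷ʳ 1F)) ∎
    where
    j = jump b x (ones a)
    t₁ = λ a → transfer g a (p ++ u₁)
    t₂ = λ a → transfer g a (p ++ u₂)
    t₃ = λ a → transfer g a (p ++ u₃)
    ih : ∀ y → t₁ (a ∷ʳ y) ≈ t₂ (a ∷ʳ y) + k * t₃ (a ∷ʳ y)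
    ih y = transfer-++-combination g n k h p (a ∷ʳ y) (≡.trans (length-∷ʳ a y) len)

  -- Reading the word from its right end.

  module Reversal
    (wt-exchange : ∀ i j → wt i * wt (suc j) ≈ wt j * wt (suc i))
    (f : ℕ → Carrier)
    (f-suc : ∀ k → f (suc k) ≈ f k + wt k * f (suc k))
    where

    completed : List Bit → List Bit → Carrier
    completed = transfer (f ∘ ones)

    -- Both sides vanish unless `x` is 1 and `y` is 0, and then this is `wt-exchange`.
    jump-exchange : ∀ x y i j →
      wt (i ℕ.+ toℕ y) * jump x y (suc j) ≈ jump x y j * wt (suc i)
    jump-exchange 0F y  i j = trans (zeroʳ _) (sym (zeroˡ _))
    jump-exchange 1F 1F i j = trans (zeroʳ _) (sym (zeroˡ _))
    jump-exchange 1F 0F i j = trans (*-congʳ (reflexive (≡.cong wt (ℕₚ.+-identityʳ i)))) (wt-exchange i j)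

    -- Trivial for equal bits. For distinct bits only one of the two jumps is nonzero, and `f-suc`
    -- remains. Both the peeling of the last bit and the invariance under trailing zeros rest on
    -- this.
    f-exchange : ∀ x y k → f (toℕ x ℕ.+ k) + jump y x k * f (suc k) ≈ f (toℕ y ℕ.+ k) + jump x y k * f (suc k)
    f-exchange 0F 0F k = refl
    f-exchange 1F 1F k = refl
    f-exchange 0F 1F k = trans (sym (f-suc k)) (sym (trans (+-congˡ (zeroˡ _)) (+-identityʳ _)))
    f-exchange 1F 0F k = trans (trans (+-congˡ (zeroˡ _)) (+-identityʳ _)) (f-suc k)

    -- Reading x = 1 changes the final weight, by f-suc, only if y = 0 is still
    -- in place.  Replacing this 0 by 1 gives each jump over it one more factor
    -- of Y, and this turns Y to the number of ones in u into Y to the number of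
    -- ones read when x is reached, by wt-exchange.
    completed-∷ʳ : ∀ y x a v u → length a ≡ length u →
      completed (a ++ y ∷ v) (u ∷ʳ x) ≈
      completed (a ++ y ∷ v) u + jump x y (ones v ℕ.+ ones u) * completed (a ++ 1F ∷ v) u
    completed-∷ʳ y x [] v [] _ = begin
      completed (v ∷ʳ x) [] + jump y x (ones v) * completed (v ∷ʳ 1F) []
        ≈⟨ +-cong (end x) (*-congˡ (end 1F)) ⟩
      f (toℕ x ℕ.+ ones v) + jump y x (ones v) * f (suc (ones v))
        ≈⟨ f-exchange x y (ones v) ⟩
      f (toℕ y ℕ.+ ones v) + jump x y (ones v) * f (suc (ones v))
        ≡⟨ ≡.cong (λ k → f (toℕ y ℕ.+ ones v) + jump x y k * f (suc (ones v))) (≡.sym (ℕₚ.+-identityʳ (ones v))) ⟩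
      f (toℕ y ℕ.+ ones v) + jump x y (ones v ℕ.+ 0) * f (suc (ones v)) ∎
      where
      end : ∀ z → completed (v ∷ʳ z) [] ≈ f (toℕ z ℕ.+ ones v)
      end z = reflexive (≡.trans (transfer-[] (f ∘ ones) (v ∷ʳ z)) (≡.cong f (ones-∷ʳ v z)))
    completed-∷ʳ y x (b ∷ a) v (z ∷ u) len = begin
      completed ((a ++ y ∷ v) ∷ʳ z) (u ∷ʳ x) + jump b z (ones (a ++ y ∷ v)) * completed ((a ++ y ∷ v) ∷ʳ 1F) (u ∷ʳ x)
        ≈⟨ +-cong (step z) (*-congˡ (step 1F)) ⟩
      (s y z + κ z * s 1F z) + jump b z (ones (a ++ y ∷ v)) * (s y 1F + κ 1F * s 1F 1F)
        ≈⟨ exchange b z ⟩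
      (s y z + jump b z (ones (a ++ y ∷ v)) * s y 1F) +
        jump x y (ones v ℕ.+ (toℕ z ℕ.+ ones u)) * (s 1F z + jump b z (ones (a ++ 1F ∷ v)) * s 1F 1F) ∎
      where
      s : Bit → Bit → Carrier
      s y z = completed ((a ++ y ∷ v) ∷ʳ z) u
      κ : Bit → Carrier
      κ z = jump x y (ones v ℕ.+ (toℕ z ℕ.+ ones u))
      count : ∀ z → ones (v ∷ʳ z) ℕ.+ ones u ≡ ones v ℕ.+ (toℕ z ℕ.+ ones u)
      count z = ≡.trans (≡.cong (ℕ._+ ones u) (≡.trans (ones-∷ʳ v z) (ℕₚ.+-comm (toℕ z) (ones v))))
                        (ℕₚ.+-assoc (ones v) (toℕ z) (ones u))
      -- Once read, `z` joins `v` behind `y`; by `count` the number of ones in the claim stays the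
      -- same.
      step : ∀ z → completed ((a ++ y ∷ v) ∷ʳ z) (u ∷ʳ x) ≈ s y z + κ z * s 1F z
      step z rewrite ++-assoc a (y ∷ v) [ z ] | ++-assoc a (1F ∷ v) [ z ] | ≡.sym (count z) =
        completed-∷ʳ y x a (v ∷ʳ z) u (ℕₚ.suc-injective len)
      wt-jump : wt (ones (a ++ y ∷ v)) * κ 1F ≈ κ 0F * wt (ones (a ++ 1F ∷ v))
      wt-jump = begin
        wt (ones (a ++ y ∷ v)) * κ 1F
          ≡⟨ ≡.cong₂ (λ i k → wt i * jump x y k)
               (≡.trans (ones-++ a (y ∷ v)) (≡.trans (≡.cong (ones a ℕ.+_) (ℕₚ.+-comm (toℕ y) (ones v))) (≡.sym (ℕₚ.+-assoc (ones a) (ones v) (toℕ y)))))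
               (ℕₚ.+-suc (ones v) (ones u)) ⟩
        wt (ones a ℕ.+ ones v ℕ.+ toℕ y) * jump x y (suc (ones v ℕ.+ ones u))
          ≈⟨ jump-exchange x y (ones a ℕ.+ ones v) (ones v ℕ.+ ones u) ⟩
        κ 0F * wt (suc (ones a ℕ.+ ones v))
          ≡⟨ ≡.cong (λ i → κ 0F * wt i) (≡.sym (≡.trans (ones-++ a (1F ∷ v)) (ℕₚ.+-suc (ones a) (ones v)))) ⟩
        κ 0F * wt (ones (a ++ 1F ∷ v)) ∎
      no-jump : ∀ S K T t t′ t″ → (S + K * T) + 0# * t ≈ (S + 0# * t′) + K * (T + 0# * t″)
      no-jump S K T t t′ t″ = trans (+-*-vanishes ≡.refl)
        (sym (+-cong (+-*-vanishes ≡.refl) (*-congˡ (+-*-vanishes ≡.refl))))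
      exchange : ∀ b z →
        (s y z + κ z * s 1F z) + jump b z (ones (a ++ y ∷ v)) * (s y 1F + κ 1F * s 1F 1F) ≈
        (s y z + jump b z (ones (a ++ y ∷ v)) * s y 1F) + κ z * (s 1F z + jump b z (ones (a ++ 1F ∷ v)) * s 1F 1F)
      exchange 0F z  = no-jump (s y z) (κ z) (s 1F z) _ _ _
      exchange 1F 1F = no-jump (s y 1F) (κ 1F) (s 1F 1F) _ _ _
      exchange 1F 0F = begin
        (s y 0F + κ 0F * s 1F 0F) + w * (s y 1F + κ 1F * s 1F 1F)
          ≈⟨ solve 7 (λ s s′ t t′ k k′ w → (s :+ k :* t) :+ w :* (s′ :+ k′ :* t′) := (s :+ w :* s′) :+ (k :* t :+ (w :* k′) :* t′)) refl
               (s y 0F) (s y 1F) (s 1F 0F) (s 1F 1F) (κ 0F) (κ 1F) w ⟩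
        (s y 0F + w * s y 1F) + (κ 0F * s 1F 0F + (w * κ 1F) * s 1F 1F)
          ≈⟨ +-congˡ (+-congˡ (trans (*-congʳ wt-jump) (*-assoc _ _ _))) ⟩
        (s y 0F + w * s y 1F) + (κ 0F * s 1F 0F + κ 0F * (w′ * s 1F 1F))
          ≈⟨ +-congˡ (sym (distribˡ _ _ _)) ⟩
        (s y 0F + w * s y 1F) + κ 0F * (s 1F 0F + w′ * s 1F 1F) ∎
        where
        w  = wt (ones (a ++ y ∷ v))
        w′ = wt (ones (a ++ 1F ∷ v))

    -- Without a ribbon at the first position, `y` becomes the last bit of the window and
    -- `completed-∷ʳ` applies with `v` empty. With a ribbon that bit becomes 1, and then `x`
    -- contributes nothing because `jump x 1F` vanishes.
    completed-∷-∷ʳ : ∀ y x u a → length a ≡ suc (length u) →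
      completed a (y ∷ u ∷ʳ x) ≈ completed a (y ∷ u) + jump x y (ones u) * completed a (1F ∷ u)
    completed-∷-∷ʳ y x u (b ∷ a) len = begin
      completed (a ∷ʳ y) (u ∷ʳ x) + j * completed (a ∷ʳ 1F) (u ∷ʳ x)
        ≈⟨ +-cong (completed-∷ʳ y x a [] u len′)
                  (*-congˡ (trans (completed-∷ʳ 1F x a [] u len′) (+-*-vanishes (jump-1F x (ones u))))) ⟩
      (completed (a ∷ʳ y) u + k * t) + j * t
        ≈⟨ solve 3 (λ s kt jt → (s :+ kt) :+ jt := (s :+ jt) :+ kt) refl _ _ _ ⟩
      (completed (a ∷ʳ y) u + j * t) + k * t
        ≈⟨ +-congˡ (*-congˡ (sym (+-*-vanishes (jump-1F b (ones a))))) ⟩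
      (completed (a ∷ʳ y) u + j * t) + k * (t + jump b 1F (ones a) * t) ∎
      where
      len′ = ℕₚ.suc-injective len
      j = jump b y (ones a)
      k = jump x y (ones u)
      t = completed (a ∷ʳ 1F) u

    -- Peel bits off the right end of the word. The bit leaving the window when the last letter is
    -- read is a 1 of the initial window, so by `completed-∷ʳ` with `y = 1F` that letter contributes
    -- nothing. The parameter `d` grows by one each time, which keeps the window length fixed.
    completed-replicate : ∀ b d →
      completed (replicate (length b ℕ.+ d) 1F) (reverse b) ≈ f (length b ℕ.+ d)
    completed-replicate []      d = reflexive (≡.trans (transfer-[] _ (replicate d 1F)) (≡.cong f (ones-replicate d)))
    completed-replicate (x ∷ b) d = begin
      completed (replicate (suc (length b ℕ.+ d)) 1F) (reverse (x ∷ b))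
        ≡⟨ ≡.cong₂ completed 1s≡ (unfold-reverse x b) ⟩
      completed (replicate (length b) 1F ++ 1F ∷ replicate d 1F) (reverse b ∷ʳ x)
        ≈⟨ completed-∷ʳ 1F x (replicate (length b) 1F) (replicate d 1F) (reverse b)
             (≡.trans (length-replicate (length b)) (≡.sym (length-reverse b))) ⟩
      completed (replicate (length b) 1F ++ 1F ∷ replicate d 1F) (reverse b) + jump x 1F _ * _
        ≈⟨ +-*-vanishes (jump-1F x _) ⟩
      completed (replicate (length b) 1F ++ 1F ∷ replicate d 1F) (reverse b)
        ≡⟨ ≡.cong (λ z → completed z (reverse b)) (replicate-++ (length b) (suc d)) ⟨
      completed (replicate (length b ℕ.+ suc d) 1F) (reverse b)
        ≈⟨ completed-replicate b (suc d) ⟩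
      f (length b ℕ.+ suc d)
        ≡⟨ ≡.cong f (ℕₚ.+-suc (length b) d) ⟩
      f (suc (length b ℕ.+ d)) ∎
      where
      1s≡ : replicate (suc (length b ℕ.+ d)) 1F ≡ replicate (length b) 1F ++ 1F ∷ replicate d 1F
      1s≡ = ≡.trans (≡.cong (λ n → replicate n 1F) (≡.sym (ℕₚ.+-suc (length b) d))) (replicate-++ (length b) (suc d))

    -- The window `b` of `path-count` stands reversed at the right end of the word read by
    -- `completed`. Peeling off its first bit `x` leaves the words in which `y`, or a 1 with factor
    -- `jump x y (ones b)`, has entered the window: the transition rule of `path-count`.
    completed-reverse : ∀ q b {n} → length b ≡ suc n →
      completed (replicate (suc n) 1F) (reverse q ++ reverse b) ≈ f (suc n) * path-count b q
    completed-reverse []      b       {n} len = begin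
      completed (replicate (suc n) 1F) (reverse b)
        ≡⟨ ≡.cong (λ m → completed (replicate m 1F) (reverse b)) len+0 ⟨
      completed (replicate (length b ℕ.+ 0) 1F) (reverse b)
        ≈⟨ completed-replicate b 0 ⟩
      f (length b ℕ.+ 0)
        ≡⟨ ≡.cong f len+0 ⟩
      f (suc n)
        ≈⟨ *-identityʳ _ ⟨
      f (suc n) * 1#
        ≡⟨ ≡.cong (f (suc n) *_) (transfer-[] (const 1#) b) ⟨
      f (suc n) * path-count b [] ∎
      where
      len+0 : length b ℕ.+ 0 ≡ suc n
      len+0 = ≡.trans (ℕₚ.+-identityʳ (length b)) len
    completed-reverse (y ∷ q) (x ∷ b) {n} len = begin
      completed 1s (reverse (y ∷ q) ++ reverse (x ∷ b))
        ≡⟨ ≡.cong₂ (λ v v′ → completed 1s (v ++ v′)) (unfold-reverse y q) (unfold-reverse x b) ⟩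
      completed 1s ((reverse q ∷ʳ y) ++ (reverse b ∷ʳ x))
        ≡⟨ ≡.cong (completed 1s) (∷ʳ-++ (reverse q) y (reverse b ∷ʳ x)) ⟩
      completed 1s (reverse q ++ y ∷ reverse b ∷ʳ x)
        ≈⟨ transfer-++-combination (f ∘ ones) (suc n) (jump x y (ones (reverse b)))
             (λ a p → completed-∷-∷ʳ y x (reverse b) a (≡.trans p (≡.trans (≡.sym len) (≡.cong suc (≡.sym (length-reverse b))))))
             (reverse q) 1s (length-replicate (suc n)) ⟩
      completed 1s (reverse q ++ y ∷ reverse b) + jump x y (ones (reverse b)) * completed 1s (reverse q ++ 1F ∷ reverse b)
        ≈⟨ +-cong (ih y) (*-cong (reflexive (≡.cong (jump x y) (ones-reverse b))) (ih 1F)) ⟩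
      f (suc n) * path-count (b ∷ʳ y) q + jump x y (ones b) * (f (suc n) * path-count (b ∷ʳ 1F) q)
        ≈⟨ solve 4 (λ f s j t → f :* s :+ j :* (f :* t) := f :* (s :+ j :* t)) refl _ _ _ _ ⟩
      f (suc n) * (path-count (b ∷ʳ y) q + jump x y (ones b) * path-count (b ∷ʳ 1F) q) ∎
      where
      1s = replicate (suc n) 1F
      ih : ∀ z → completed 1s (reverse q ++ z ∷ reverse b) ≈ f (suc n) * path-count (b ∷ʳ z) q
      ih z = begin
        completed 1s (reverse q ++ z ∷ reverse b)
          ≡⟨ ≡.cong (λ v → completed 1s (reverse q ++ v)) (reverse-++ b [ z ]) ⟨
        completed 1s (reverse q ++ reverse (b ∷ʳ z))
          ≈⟨ completed-reverse q (b ∷ʳ z) (≡.trans (length-∷ʳ b z) len) ⟩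
        f (suc n) * path-count (b ∷ʳ z) q ∎

    -- By `f-exchange` with `x = 0F`, the final weight `f ∘ ones` is a fixed point of reading one
    -- zero.
    completed-++-0s : ∀ u k a → completed a (u ++ replicate k 0F) ≈ completed a u
    completed-++-0s []      zero    a       = refl
    completed-++-0s []      (suc k) []      = refl
    completed-++-0s []      (suc k) (b ∷ a) = begin
      completed (a ∷ʳ 0F) (replicate k 0F) + jump b 0F (ones a) * completed (a ∷ʳ 1F) (replicate k 0F)
        ≈⟨ +-cong (end 0F) (*-congˡ (end 1F)) ⟩
      f (ones a) + jump b 0F (ones a) * f (suc (ones a))
        ≈⟨ f-exchange 0F b (ones a) ⟩
      f (toℕ b ℕ.+ ones a) + 0# * f (suc (ones a))
        ≈⟨ +-*-vanishes ≡.refl ⟩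
      f (toℕ b ℕ.+ ones a) ∎
      where
      end : ∀ z → completed (a ∷ʳ z) (replicate k 0F) ≈ f (toℕ z ℕ.+ ones a)
      end z = trans (completed-++-0s [] k (a ∷ʳ z))
        (reflexive (≡.trans (transfer-[] _ (a ∷ʳ z)) (≡.cong f (ones-∷ʳ a z))))
    completed-++-0s (x ∷ u) k []      = refl
    completed-++-0s (x ∷ u) k (b ∷ a) =
      +-cong (completed-++-0s u k (a ∷ʳ x)) (*-congˡ (completed-++-0s u k (a ∷ʳ 1F)))

    completed-path-count : ∀ w n →
      completed (replicate (suc n) 1F) w ≈ f (suc n) * path-count (replicate (suc n) 0F) (reverse w)
    completed-path-count w n = begin
      completed 1s w
        -- The appended zeros serve as the reversed initial window of `path-count`.
        ≈⟨ completed-++-0s w (suc n) 1s ⟨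
      completed 1s (w ++ replicate (suc n) 0F)
        ≡⟨ ≡.cong₂ (λ v v′ → completed 1s (v ++ v′)) (reverse-involutive w) (reverse-replicate (suc n)) ⟨
      completed 1s (reverse (reverse w) ++ reverse (replicate (suc n) 0F))
        ≈⟨ completed-reverse (reverse w) (replicate (suc n) 0F) (length-replicate (suc n)) ⟩
      f (suc n) * path-count (replicate (suc n) 0F) (reverse w) ∎
      where 1s = replicate (suc n) 1F

-- Bit sequences indexed by integers.

applyUpTo-cong : ∀ {ℓ} {A : Set ℓ} {f g : ℕ → A} n → (∀ j → j ℕ.< n → f j ≡ g j) → applyUpTo f n ≡ applyUpTo g n
applyUpTo-cong zero    f≡g = ≡.refl
applyUpTo-cong (suc n) f≡g = ≡.cong₂ _∷_ (f≡g 0 (s≤s z≤n)) (applyUpTo-cong n (λ j j<n → f≡g (suc j) (s≤s j<n)))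

applyUpTo-extend : ∀ b c w m → applyUpTo (λ j → extend b c w (+ j)) (length w ℕ.+ m) ≡ w ++ replicate m c
applyUpTo-extend b c []      zero    = ≡.refl
applyUpTo-extend b c []      (suc m) = ≡.cong (c ∷_) (applyUpTo-extend b c [] m)
applyUpTo-extend b c (x ∷ w) m       = ≡.cong (x ∷_) (applyUpTo-extend b c w m)

i≢i+suc : ∀ i k → i ≢ i ℤ.+ + suc k
i≢i+suc i k eq = contradiction (≡.trans cancel (≡.trans (≡.cong (ℤ._- i) (≡.sym eq)) (ℤₚ.i≡j⇒i-j≡0 {i} ≡.refl))) λ ()
  where
  cancel : + suc k ≡ i ℤ.+ + suc k ℤ.- i
  cancel = solve 2 (λ i k → k := i :+ k :- i) ≡.refl i (+ suc k)
    where open +-*-Solver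

+-suc : ∀ i m → i ℤ.+ + suc m ≡ ℤ.suc i ℤ.+ + m
+-suc i m = solve 2 (λ i m → i :+ (con (+ 1) :+ m) := con (+ 1) :+ i :+ m) ≡.refl i (+ m)
  where open +-*-Solver

-- Enumeration of placements from left to right, for ribbons of length `suc r`.

module Scanning (r : ℕ) where

  open Ribbons (suc r)
    using ( Addable; add; height; placements; IsPlacement; sequences; isPlacement?
          ; ∈-placements; placements-unique; []; _∷_)
  open +-*-Solver

  addable? : ∀ s i → Dec (Addable s i)
  addable? s i = s (i ℤ.- + suc r) ≟ᵇ 1F ×-dec s i ≟ᵇ 0F

  startingAt : ∀ {p} {P : Set p} → Dec P → ℤ → List (List ℤ) → List (List ℤ)
  startingAt (yes _) i iss = map (i ∷_) iss
  startingAt (no _)  i iss = []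

  -- Only the `m` positions from `i` on are available. Branching on whether `i` is used mirrors the
  -- transition rule of `transfer`.
  scan : BitSequence → ℤ → ℕ → ℕ → List (List ℤ)
  scan s i m       zero    = [ [] ]
  scan s i zero    (suc n) = []
  scan s i (suc m) (suc n) =
    scan s (ℤ.suc i) m (suc n) ++ startingAt (addable? s i) i (scan (add i s) (ℤ.suc i) m n)

  ∈-startingAt⁻ : ∀ {p} {P : Set p} (d : Dec P) {i iss is} → is ∈ startingAt d i iss →
    P × ∃[ is′ ] (is′ ∈ iss × is ≡ i ∷ is′)
  ∈-startingAt⁻ (yes p) is∈ = p , ∈-map⁻ (_ ∷_) is∈

  ∈-startingAt⁺ : ∀ {p} {P : Set p} (d : Dec P) {i iss is} → P → is ∈ iss → i ∷ is ∈ startingAt d i iss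
  ∈-startingAt⁺ (yes _) p is∈ = ∈-map⁺ (_ ∷_) is∈
  ∈-startingAt⁺ (no ¬p) p is∈ = contradiction p ¬p

  ∈-scan⁻ : ∀ s i m n {is} → is ∈ scan s i m n → length is ≡ n × IsPlacement s is × All (i ℤ.≤_) is
  ∈-scan⁻ s i m       zero    (here ≡.refl) = ≡.refl , ([] , []) , []
  ∈-scan⁻ s i (suc m) (suc n) is∈ with ∈-++⁻ (scan s (ℤ.suc i) m (suc n)) is∈
  ... | inj₁ is∈ˡ =
    let len , pl , later = ∈-scan⁻ s (ℤ.suc i) m (suc n) is∈ˡ in
    len , pl , All.map (ℤₚ.≤-trans (ℤₚ.i≤suc[i] i)) later
  ... | inj₂ is∈ʳ with ∈-startingAt⁻ (addable? s i) is∈ʳ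
  ...   | p , is′ , is′∈ , ≡.refl =
    let len , (lk , ps) , later = ∈-scan⁻ (add i s) (ℤ.suc i) m n is′∈ in
    ≡.cong suc len , (linked lk later , p ∷ ps) , ℤₚ.≤-refl ∷ All.map (ℤₚ.≤-trans (ℤₚ.i≤suc[i] i)) later
    where
    linked : ∀ {is} → Linked ℤ._<_ is → All (ℤ.suc i ℤ.≤_) is → Linked ℤ._<_ (i ∷ is)
    linked []         []        = [-]
    linked [-]        (p ∷ _)   = ℤₚ.suc[i]≤j⇒i<j p ∷ [-]
    linked (q ∷ lk)   (p ∷ _)   = ℤₚ.suc[i]≤j⇒i<j p ∷ q ∷ lk

  -- As positions increase, either the first one is `i` or all of them exceed `i`; this selects the
  -- branch.
  ∈-scan⁺ : ∀ s i m is → IsPlacement s is → All (i ℤ.≤_) is → All (ℤ._< i ℤ.+ + m) is → is ∈ scan s i m (length is)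
  ∈-scan⁺ s i m       []       _              _          _         = here ≡.refl
  ∈-scan⁺ s i zero    (j ∷ is) _              (i≤j ∷ _)  (j<i ∷ _) =
    contradiction (ℤₚ.<-≤-trans (≡.subst (j ℤ.<_) (ℤₚ.+-identityʳ i) j<i) i≤j) (ℤₚ.<-irrefl ≡.refl)
  ∈-scan⁺ s i (suc m) (j ∷ is) (lk , p ∷ ps) (i≤j ∷ _) below with i ℤₚ.≟ j
  ... | no i≢j = ∈-++⁺ˡ (∈-scan⁺ s (ℤ.suc i) m (j ∷ is) (lk , p ∷ ps)
          (All.map ℤₚ.i<j⇒suc[i]≤j (Linked⇒All ℤₚ.<-trans (ℤₚ.≤∧≢⇒< i≤j i≢j) lk))
          (≡.subst (λ e → All (ℤ._< e) (j ∷ is)) (+-suc i m) below))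
  ... | yes ≡.refl = ∈-++⁺ʳ (scan s (ℤ.suc i) m (suc (length is)))
          (∈-startingAt⁺ (addable? s i) p (∈-scan⁺ (add i s) (ℤ.suc i) m is
            (Linked.tail lk , ps)
            (All.map ℤₚ.i<j⇒suc[i]≤j (AllPairs.head (Linked⇒AllPairs ℤₚ.<-trans lk)))
            (≡.subst (λ e → All (ℤ._< e) is) (+-suc i m) (All.tail below))))

  scan-unique : ∀ s i m n → Unique (scan s i m n)
  scan-unique s i m       zero    = [] ∷ []
  scan-unique s i zero    (suc n) = []
  scan-unique s i (suc m) (suc n) = Uniqueₚ.++⁺ (scan-unique s (ℤ.suc i) m (suc n)) (starting-unique (addable? s i)) disjoint
    where
    starting-unique : ∀ {p} {P : Set p} (d : Dec P) → Unique (startingAt d i (scan (add i s) (ℤ.suc i) m n))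
    starting-unique (yes _) = Uniqueₚ.map⁺ ∷-injectiveʳ (scan-unique (add i s) (ℤ.suc i) m n)
    starting-unique (no _)  = []
    -- A common element would start with `i`, but all positions in the first branch are at least
    -- `ℤ.suc i`.
    disjoint : Disjoint (scan s (ℤ.suc i) m (suc n)) (startingAt (addable? s i) i (scan (add i s) (ℤ.suc i) m n))
    disjoint (p , q) with ∈-startingAt⁻ (addable? s i) q
    ... | _ , _ , _ , ≡.refl with ∈-scan⁻ s (ℤ.suc i) m (suc n) p
    ...   | _ , _ , suc[i]≤i ∷ _ = ℤₚ.<-irrefl ≡.refl (ℤₚ.suc[i]≤j⇒i<j suc[i]≤i)

  ∈-sequences-All : ∀ n {xs is} → is ∈ sequences n xs → All (_∈ xs) is
  ∈-sequences-All zero         (here ≡.refl) = []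
  ∈-sequences-All (suc n) {xs} is∈ with ∈-cartesianProductWith⁻ _∷_ xs (sequences n xs) is∈
  ... | _ , _ , i∈ , is∈′ , ≡.refl = i∈ ∷ ∈-sequences-All n is∈′

  -- Two duplicate-free lists with the same members are permutations of each other; this suffices
  -- because the weights are only summed.
  placements-↭-scan : ∀ b c w n →
    placements b c w n ↭ scan (extend b c w) (+ 0) (n ℕ.* suc r ℕ.+ length w) n
  placements-↭-scan b c w n = ∼bag⇒↭ (unique∧set⇒bag
    (placements-unique b c w n) (scan-unique (extend b c w) (+ 0) N n) (λ {is} → mk⇔ (to is) (from is)))
    where
    N = n ℕ.* suc r ℕ.+ length w
    window-bounds : ∀ {i} → i ∈ map +_ (upTo N) → + 0 ℤ.≤ i × i ℤ.< + N
    window-bounds i∈ with ∈-map⁻ +_ i∈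
    ... | k , k∈ , ≡.refl = ℤ.+≤+ z≤n , ℤ.+<+ (∈-upTo⁻ k∈)
    to : ∀ is → is ∈ placements b c w n → is ∈ scan (extend b c w) (+ 0) N n
    to is is∈ with Equivalence.to (∈-placements b c w n is) is∈
                 | ∈-sequences-All n (proj₁ (∈-filter⁻ (isPlacement? (extend b c w)) {xs = sequences n (map +_ (upTo N))} is∈))
    ... | ≡.refl , pl | bounds = ∈-scan⁺ (extend b c w) (+ 0) N is pl
            (All.map (proj₁ ∘ window-bounds) bounds) (All.map (proj₂ ∘ window-bounds) bounds)
    from : ∀ is → is ∈ scan (extend b c w) (+ 0) N n → is ∈ placements b c w n
    from is is∈ = let len , pl , _ = ∈-scan⁻ (extend b c w) (+ 0) N n is∈ in
      Equivalence.from (∈-placements b c w n is) (len , pl)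

  -- The window, the unread bits, and the effect of a ribbon on both.

  window : BitSequence → ℤ → List Bit
  window s i = applyUpTo (λ j → s (i ℤ.- + suc r ℤ.+ + j)) (suc r)

  -- The bits strictly between the two ends of a ribbon placed at `i`, which determine its height.
  window-tail : BitSequence → ℤ → List Bit
  window-tail s i = applyUpTo (λ j → s (i ℤ.- + r ℤ.+ + j)) r

  ahead : BitSequence → ℤ → ℕ → List Bit
  ahead s i m = applyUpTo (λ j → s (i ℤ.+ + j)) m

  window-∷ : ∀ s i → window s i ≡ s (i ℤ.- + suc r) ∷ window-tail s i
  window-∷ s i = ≡.cong₂ _∷_ (≡.cong s (ℤₚ.+-identityʳ (i ℤ.- + suc r)))
    (applyUpTo-cong r λ j _ → ≡.cong s
      (solve 3 (λ i r j → i :- (con (+ 1) :+ r) :+ (con (+ 1) :+ j) := i :- r :+ j) ≡.refl i (+ r) (+ j)))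

  window-suc : ∀ s i → window s (ℤ.suc i) ≡ window-tail s i ∷ʳ s i
  window-suc s i = ≡.trans
    (applyUpTo-cong (suc r) λ j _ → ≡.cong s
      (solve 3 (λ i r j → con (+ 1) :+ i :- (con (+ 1) :+ r) :+ j := i :- r :+ j) ≡.refl i (+ r) (+ j)))
    (≡.trans (≡.sym (applyUpTo-∷ʳ (λ j → s (i ℤ.- + r ℤ.+ + j)) r))
      (≡.cong (λ j → window-tail s i ∷ʳ s j) (solve 2 (λ i r → i :- r :+ r := i) ≡.refl i (+ r))))

  ahead-suc : ∀ s i m → ahead s i (suc m) ≡ s i ∷ ahead s (ℤ.suc i) m
  ahead-suc s i m = ≡.cong₂ _∷_ (≡.cong s (ℤₚ.+-identityʳ i)) (applyUpTo-cong m λ j _ → ≡.cong s (+-suc i j))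

  add-self : ∀ s i → add i s i ≡ 1F
  add-self s i with i ℤₚ.≟ i ℤ.- + suc r | i ℤₚ.≟ i
  ... | yes i≡ | _      = contradiction (≡.trans (≡.sym i≡) (solve 2 (λ i r → i := i :- r :+ r) ≡.refl i (+ suc r))) (i≢i+suc (i ℤ.- + suc r) r)
  ... | no _   | yes _  = ≡.refl
  ... | no _   | no i≢i = contradiction ≡.refl i≢i

  add-other : ∀ s i j → j ≢ i ℤ.- + suc r → j ≢ i → add i s j ≡ s j
  add-other s i j p q with j ℤₚ.≟ i ℤ.- + suc r | j ℤₚ.≟ i
  ... | yes e | _     = contradiction e p
  ... | no _  | yes e = contradiction e q
  ... | no _  | no _  = ≡.refl

  -- The two changed positions, `i - suc r` and `i`, lie immediately before and after this stretch.
  window-tail-add : ∀ s i → window-tail (add i s) i ≡ window-tail s i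
  window-tail-add s i = applyUpTo-cong r λ j j<r → add-other s i (i ℤ.- + r ℤ.+ + j) (above j) (below j j<r)
    where
    above : ∀ j → i ℤ.- + r ℤ.+ + j ≢ i ℤ.- + suc r
    above j eq = i≢i+suc (i ℤ.- + suc r) j (≡.trans (≡.sym eq)
      (solve 3 (λ i r j → i :- r :+ j := i :- (con (+ 1) :+ r) :+ (con (+ 1) :+ j)) ≡.refl i (+ r) (+ j)))
    below : ∀ j → j ℕ.< r → i ℤ.- + r ℤ.+ + j ≢ i
    below j j<r eq with ℕₚ.m≤n⇒∃[o]m+o≡n j<r
    ... | d , ≡.refl = i≢i+suc (i ℤ.- + r ℤ.+ + j) d (≡.trans eq
      (solve 3 (λ i d j → i := i :- (con (+ 1) :+ (j :+ d)) :+ j :+ (con (+ 1) :+ d)) ≡.refl i (+ d) (+ j)))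

  window-add : ∀ s i → window (add i s) (ℤ.suc i) ≡ window-tail s i ∷ʳ 1F
  window-add s i = ≡.trans (window-suc (add i s) i) (≡.cong₂ _∷ʳ_ (window-tail-add s i) (add-self s i))

  -- Both changed positions are less than `ℤ.suc i`, so the unread bits keep no memory of the
  -- ribbon.
  ahead-add : ∀ s i m → ahead (add i s) (ℤ.suc i) m ≡ ahead s (ℤ.suc i) m
  ahead-add s i m = applyUpTo-cong m λ j _ → add-other s i (ℤ.suc i ℤ.+ + j)
    (λ eq → i≢i+suc (i ℤ.- + suc r) (suc r ℕ.+ j) (≡.trans (≡.sym eq)
      (solve 3 (λ i r j → con (+ 1) :+ i :+ j := i :- r :+ (con (+ 1) :+ (r :+ j))) ≡.refl i (+ suc r) (+ j))))
    (λ eq → i≢i+suc i j (≡.trans (≡.sym eq) (≡.sym (+-suc i j))))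

  window-extend : ∀ b c w → window (extend b c w) (+ 0) ≡ replicate (suc r) b
  window-extend b c w = ≡.trans (applyUpTo-cong (suc r) left) (applyUpTo-const (suc r))
    where
    left : ∀ j → j ℕ.< suc r → extend b c w (+ 0 ℤ.- + suc r ℤ.+ + j) ≡ b
    left j j<r with ℕₚ.m≤n⇒∃[o]m+o≡n j<r
    ... | d , ≡.refl = ≡.cong (extend b c w)
      (solve 2 (λ j d → con (+ 0) :- (con (+ 1) :+ (j :+ d)) :+ j := :- (con (+ 1) :+ d)) ≡.refl (+ j) (+ d))
    applyUpTo-const : ∀ n → applyUpTo (λ _ → b) n ≡ replicate n b
    applyUpTo-const zero    = ≡.refl
    applyUpTo-const (suc n) = ≡.cong (b ∷_) (applyUpTo-const n)

  -- `height` reads the bits from right to left and the window from left to right, so the induction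
  -- takes the last bit off the window.
  height-window-tail : ∀ s i → height s i ≡ ones (window-tail s i)
  height-window-tail s = go r
    where
    go : ∀ m i → sum (applyUpTo (λ j → toℕ (s (i ℤ.- + suc j))) m) ≡ ones (applyUpTo (λ j → s (i ℤ.- + m ℤ.+ + j)) m)
    go zero    i = ≡.refl
    go (suc m) i = ≡.sym (≡.trans
      (≡.trans (≡.cong ones (≡.sym (applyUpTo-∷ʳ (λ j → s (i ℤ.- + suc m ℤ.+ + j)) m)))
        (ones-∷ʳ (applyUpTo (λ j → s (i ℤ.- + suc m ℤ.+ + j)) m) _))
      (≡.cong₂ ℕ._+_
        (≡.cong (toℕ ∘ s) (solve 2 (λ i m → i :- (con (+ 1) :+ m) :+ m := i :- con (+ 1)) ≡.refl i (+ m)))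
        (≡.trans
          (≡.cong ones (applyUpTo-cong m λ j _ → ≡.cong s
            (solve 3 (λ i m j → i :- (con (+ 1) :+ m) :+ j := i :- con (+ 1) :- m :+ j) ≡.refl i (+ m) (+ j))))
          (≡.trans (≡.sym (go m (i ℤ.- + 1)))
            (≡.cong sum (applyUpTo-cong m λ j _ → ≡.cong (toℕ ∘ s)
              (solve 2 (λ i j → i :- con (+ 1) :- (con (+ 1) :+ j) := i :- (con (+ 1) :+ (con (+ 1) :+ j))) ≡.refl i (+ j))))))))

-- Weights in geometric progression and products of geometric series.

module Weights {c ℓ} (A : CommutativeRing c ℓ) where

  open CommutativeRing A hiding (zero)
  open CommutativeMonoidSum *-commutativeMonoid using (sum-init-last; sum-cong-≋) renaming (sum to product′)
  open RingProperties ring using (-‿distribˡ-*)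
  open CommutativeSemigroupProperties *-commutativeSemigroup using (x∙yz≈y∙xz)
  open SemiringSolver commutativeSemiring using (solve; _:*_; _:=_)
  open SetoidReasoning setoid

  -- Both sides equal `x * x * y * p i * p j`.
  exchange : ∀ x y (p : ℕ → Carrier) → (∀ h → p (suc h) ≈ y * p h) →
    ∀ i j → (x * p i) * (x * p (suc j)) ≈ (x * p j) * (x * p (suc i))
  exchange x y p p-suc i j = begin
    (x * p i) * (x * p (suc j))   ≈⟨ *-congˡ (*-congˡ (p-suc j)) ⟩
    (x * p i) * (x * (y * p j))   ≈⟨ solve 4 (λ x y p q → (x :* p) :* (x :* (y :* q)) := (x :* q) :* (x :* (y :* p))) refl x y (p i) (p j) ⟩
    (x * p j) * (x * (y * p i))   ≈⟨ *-congˡ (*-congˡ (p-suc i)) ⟨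
    (x * p j) * (x * p (suc i))   ∎

  module GeometricProduct (t g : ℕ → Carrier) (inverse : ∀ h → (1# - t h) * g h ≈ 1#) where

    unfold : ∀ h → g h ≈ 1# + t h * g h
    unfold h = begin
      g h                                  ≈⟨ +-identityʳ _ ⟨
      g h + 0#                             ≈⟨ +-congˡ (-‿inverseˡ _) ⟨
      g h + (- (t h * g h) + t h * g h)    ≈⟨ +-assoc _ _ _ ⟨
      g h + - (t h * g h) + t h * g h      ≈⟨ +-congʳ (+-cong (*-identityˡ _) (sym (-‿distribˡ-* _ _))) ⟨
      1# * g h + - t h * g h + t h * g h   ≈⟨ +-congʳ (distribʳ _ _ _) ⟨
      (1# - t h) * g h + t h * g h         ≈⟨ +-congʳ (inverse h) ⟩
      1# + t h * g h                       ∎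

    -- Taken over `Fin k` so that it specialises by definition to the product in the theorem.
    product : ℕ → Carrier
    product k = product′ {k} (λ h → g (toℕ h))

    product-last : ∀ k → product (suc k) ≈ product k * g k
    product-last k = trans (sum-init-last {k} (λ h → g (toℕ h)))
      (*-cong (sum-cong-≋ {k} λ h → reflexive (≡.cong g (toℕ-inject₁ h)))
              (reflexive (≡.cong g (toℕ-fromℕ k))))

    -- Expand the last factor by `g k = 1 + t k * g k`.
    product-suc : ∀ k → product (suc k) ≈ product k + t k * product (suc k)
    product-suc k = begin
      product (suc k)                           ≈⟨ product-last k ⟩
      product k * g k                           ≈⟨ *-congˡ (unfold k) ⟩
      product k * (1# + t k * g k)              ≈⟨ distribˡ _ _ _ ⟩
      product k * 1# + product k * (t k * g k)  ≈⟨ +-cong (*-identityʳ _) (x∙yz≈y∙xz _ _ _) ⟩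
      product k + t k * (product k * g k)       ≈⟨ +-congˡ (*-congˡ (product-last k)) ⟨
      product k + t k * product (suc k)         ∎

-- Coefficients of power series: finitely many trailing zeros suffice for each.

module SeriesPaths {c ℓ} (A : CommutativeRing c ℓ) (y : CommutativeRing.Carrier A) where

  private
    module K = CommutativeRing A
    module S = PowerSeries A
  open CommutativeRing S.commutativeRing hiding (zero)
  open SemiringExp K.semiring using (^-homo-*) renaming (_^_ to _^ᴷ_)
  open S using (at; coefficientwise)
  private module KSum = SemiringSum K.semiring

  open Weights S.commutativeRing using (exchange; module GeometricProduct)

  constant-* : ∀ a g n → (S.constant a * g) n K.≈ a K.* g n
  constant-* a g zero    = K.+-identityʳ _
  constant-* a g (suc n) = K.trans (K.+-congˡ (zeroˡ g .at n)) (K.+-identityʳ _)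

  X-*-zero : ∀ g → (S.X * g) 0 K.≈ K.0#
  X-*-zero g = K.trans (K.+-identityʳ _) (K.zeroˡ _)

  X-*-suc : ∀ g n → (S.X * g) (suc n) K.≈ g n
  X-*-suc g n = K.trans (K.+-congʳ (K.zeroˡ _)) (K.trans (K.+-identityˡ _)
    (K.trans (*-congʳ {g} {S.X ∘ suc} {1#} (coefficientwise λ { zero → K.refl ; (suc _) → K.refl }) .at n) (*-identityˡ g .at n)))

  constant-homo : ∀ a b → S.constant (a K.* b) ≈ S.constant a * S.constant b
  constant-homo a b .at zero    = K.sym (constant-* a (S.constant b) 0)
  constant-homo a b .at (suc n) = K.sym (K.trans (constant-* a (S.constant b) (suc n)) (K.zeroʳ a))

  -- Coefficient `k` of a product involves only coefficients of index at most `k`.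
  *-congˡ-upTo : ∀ p {g h n} → (∀ k → k ℕ.≤ n → g k K.≈ h k) → ∀ k → k ℕ.≤ n → (p * g) k K.≈ (p * h) k
  *-congˡ-upTo p g≈h k k≤n = KSum.sum-cong-≋ λ (i : Fin (suc k)) →
    K.*-congˡ {p (toℕ i)} (g≈h (k ℕ.∸ toℕ i) (ℕₚ.≤-trans (ℕₚ.m∸n≤m k (toℕ i)) k≤n))

  wt : ℕ → Carrier
  wt h = S.X * S.constant (y ^ᴷ h)

  wt-*-zero : ∀ h g → (wt h * g) 0 K.≈ K.0#
  wt-*-zero h g = K.trans (*-assoc S.X (S.constant (y ^ᴷ h)) g .at 0) (X-*-zero (S.constant (y ^ᴷ h) * g))

  wt-*-suc : ∀ h g n → (wt h * g) (suc n) K.≈ y ^ᴷ h K.* g n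
  wt-*-suc h g n = K.trans (*-assoc S.X (S.constant (y ^ᴷ h)) g .at (suc n))
    (K.trans (X-*-suc (S.constant (y ^ᴷ h) * g) n) (constant-* (y ^ᴷ h) g n))

  -- Makes `⁻¹` a genuine inverse at these series.
  constant-term : ∀ h → (1# - wt h) 0 K.≈ K.1#
  constant-term h = K.trans
    (K.+-congˡ (K.trans (K.-‿cong (X-*-zero (S.constant (y ^ᴷ h)))) (RingProperties.-0#≈0# K.ring)))
    (K.+-identityʳ K.1#)

  private
    open module T = Transfer S.commutativeRing wt

  wt-exchange : ∀ i j → wt i * wt (suc j) ≈ wt j * wt (suc i)
  wt-exchange = exchange S.X (S.constant y) (λ h → S.constant (y ^ᴷ h)) (λ h → constant-homo y (y ^ᴷ h))

  open GeometricProduct wt (λ h → (1# - wt h) S.⁻¹)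
    (λ h → S.⁻¹-inverseʳ (1# - wt h) (constant-term h))
    renaming (product to f; product-suc to f-suc) public

  open T.Reversal wt-exchange f f-suc

  f-constant-term : ∀ k → f k 0 K.≈ K.1#
  f-constant-term zero    = K.refl
  f-constant-term (suc k) = K.trans (f-suc k .at 0)
    (K.trans (K.+-congˡ (wt-*-zero k (f (suc k)))) (K.trans (K.+-identityʳ _) (f-constant-term k)))

  jump-*-zero : ∀ b x h g → (jump b x h * g) 0 K.≈ K.0#
  jump-*-zero 0F x  h g = zeroˡ g .at 0
  jump-*-zero 1F 1F h g = zeroˡ g .at 0
  jump-*-zero 1F 0F h g = wt-*-zero h g

  path-count-constant-term : ∀ u a → path-count a u 0 K.≈ K.1#
  path-count-constant-term u       []      = K.refl
  path-count-constant-term []      (b ∷ a) = K.refl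
  path-count-constant-term (x ∷ u) (b ∷ a) = K.trans
    (K.+-congˡ (jump-*-zero b x (ones a) (path-count (a ∷ʳ 1F) u)))
    (K.trans (K.+-identityʳ _) (path-count-constant-term u (a ∷ʳ x)))

  -- The last 1 of the window lies in c, so it jumps or is left behind within
  -- length c steps; after a jump the next r steps decide in the same way.
  path-count-stable : ∀ {r} m n c j → length c ℕ.+ j ℕ.≤ r → n ℕ.* r ℕ.≤ m ℕ.+ j →
    path-count (c ++ replicate j 0F) (replicate m 0F) n K.≈ f (ones c) n
  path-count-stable m zero c j _ _ =
    K.trans (path-count-constant-term (replicate m 0F) (c ++ replicate j 0F)) (K.sym (f-constant-term (ones c)))
  path-count-stable m (suc n) [] j _ _ = path-count-0s m j .at (suc n)
  -- Impossible: the second bound gives `r ≤ j`, while a nonempty first part of the window forces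
  -- `j < r`.
  path-count-stable {r} zero (suc n) (b ∷ c) j len≤r r≤j =
    contradiction (ℕₚ.≤-trans (s≤s (ℕₚ.m≤n+m j (length c))) (ℕₚ.≤-trans len≤r (ℕₚ.m+n≤o⇒m≤o r r≤j))) (ℕₚ.<-irrefl ≡.refl)
  path-count-stable {r} (suc m) (suc n) (b ∷ c) j len≤r bound = by-first b
    where
    a = c ++ replicate j 0F
    ones-a : ones a ≡ ones c
    ones-a = ≡.trans (ones-++ c (replicate j 0F)) (≡.trans (≡.cong (ones c ℕ.+_) (ones-0s j)) (ℕₚ.+-identityʳ (ones c)))
    length-a∷ʳ1F : length (a ∷ʳ 1F) ≡ suc (length c ℕ.+ j)
    length-a∷ʳ1F = ≡.trans (length-∷ʳ a 1F)
      (≡.cong suc (≡.trans (length-++ c) (≡.cong (length c ℕ.+_) (length-replicate j))))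
    a∷ʳ0F : c ++ replicate (suc j) 0F ≡ a ∷ʳ 0F
    a∷ʳ0F = ≡.trans (≡.cong (c ++_) (≡.sym (replicate-∷ʳ j))) (≡.sym (++-assoc c (replicate j 0F) [ 0F ]))
    -- A jump uses up one block of `r` zeros: since `suc j ≤ r`, cancelling `suc j` in the old bound
    -- leaves the new one, with `j` restarted at 0.
    bound′ : n ℕ.* r ℕ.≤ m ℕ.+ 0
    bound′ = ℕₚ.+-cancelˡ-≤ (suc j) (n ℕ.* r) (m ℕ.+ 0) (begin
      suc j ℕ.+ n ℕ.* r   ≤⟨ ℕₚ.+-monoˡ-≤ (n ℕ.* r) (ℕₚ.≤-trans (s≤s (ℕₚ.m≤n+m j (length c))) len≤r) ⟩
      r ℕ.+ n ℕ.* r       ≤⟨ bound ⟩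
      suc (m ℕ.+ j)       ≡⟨ ≡.cong suc (ℕₚ.+-comm m j) ⟩
      suc j ℕ.+ m         ≡⟨ ≡.cong (suc j ℕ.+_) (ℕₚ.+-identityʳ m) ⟨
      suc j ℕ.+ (m ℕ.+ 0) ∎)
      where open ℕₚ.≤-Reasoning
    P : Bit → Carrier
    P z = path-count (a ∷ʳ z) (replicate m 0F)
    stays : P 0F (suc n) K.≈ f (ones c) (suc n)
    stays = K.trans (K.reflexive (≡.cong (λ a → path-count a (replicate m 0F) (suc n)) (≡.sym a∷ʳ0F)))
      (path-count-stable m (suc n) c (suc j)
        (≡.subst (ℕ._≤ r) (≡.sym (ℕₚ.+-suc (length c) j)) len≤r)
        (≡.subst (suc n ℕ.* r ℕ.≤_) (≡.sym (ℕₚ.+-suc m j)) bound))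
    jumps : P 1F n K.≈ f (suc (ones c)) n
    jumps = K.trans (K.reflexive (≡.cong (λ a → path-count a (replicate m 0F) n) (≡.sym (++-identityʳ (a ∷ʳ 1F)))))
      (K.trans
        (path-count-stable m n (a ∷ʳ 1F) 0
          (≡.subst (ℕ._≤ r) (≡.sym (≡.trans (ℕₚ.+-identityʳ (length (a ∷ʳ 1F))) length-a∷ʳ1F)) len≤r)
          bound′)
        (K.reflexive (≡.cong (λ k → f k n) (≡.trans (ones-∷ʳ a 1F) (≡.cong suc ones-a)))))
    by-first : ∀ b → (P 0F + jump b 0F (ones a) * P 1F) (suc n) K.≈ f (ones (b ∷ c)) (suc n)
    by-first 0F = K.trans (+-*-vanishes {q = P 1F} {P 0F} ≡.refl .at (suc n)) stays
    -- The two branches match the two terms of `f-suc (ones c)`.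
    by-first 1F = K.trans (K.+-cong stays (K.trans (wt-*-suc (ones a) (P 1F) n)
        (K.*-cong (K.reflexive (≡.cong (y ^ᴷ_) ones-a)) jumps)))
      (K.sym (K.trans (f-suc (ones c) .at (suc n)) (K.+-congˡ (wt-*-suc (ones c) (f (suc (ones c))) n))))

  -- Agreement is required at every `k ≤ n`, because multiplication by a jump mixes in lower
  -- coefficients.
  transfer-cong-upTo : ∀ {g h N n} →
    (∀ a → length a ≡ N → ∀ k → k ℕ.≤ n → g a k K.≈ h a k) →
    ∀ a u → length a ≡ N → ∀ k → k ℕ.≤ n → transfer g a u k K.≈ transfer h a u k
  transfer-cong-upTo g≈h []      u       len k k≤n = g≈h [] len k k≤n
  transfer-cong-upTo g≈h (b ∷ a) []      len k k≤n = g≈h (b ∷ a) len k k≤n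
  transfer-cong-upTo {g} {h} g≈h (b ∷ a) (x ∷ u) len k k≤n = K.+-cong (ih x k k≤n)
    (*-congˡ-upTo (jump b x (ones a)) {transfer g (a ∷ʳ 1F) u} {transfer h (a ∷ʳ 1F) u} (ih 1F) k k≤n)
    where
    ih : ∀ z k → k ℕ.≤ _ → transfer g (a ∷ʳ z) u k K.≈ transfer h (a ∷ʳ z) u k
    ih z = transfer-cong-upTo {g} {h} g≈h (a ∷ʳ z) u (≡.trans (length-∷ʳ a z) len)

  -- After `w`, the remaining zeros settle all coefficients up to `n` by `path-count-stable`, so
  -- their reading can be replaced by the final weight `f ∘ ones`.
  path-count-++-0s : ∀ a w n → path-count a (w ++ replicate (n ℕ.* length a) 0F) n K.≈ completed a w n
  path-count-++-0s a w n = K.trans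
    (K.reflexive (≡.cong (λ s → s n) (transfer-++ (const 1#) a w (replicate (n ℕ.* length a) 0F))))
    (transfer-cong-upTo stable a w ≡.refl n ℕₚ.≤-refl)
    where
    stable : ∀ b → length b ≡ length a → ∀ k → k ℕ.≤ n →
      path-count b (replicate (n ℕ.* length a) 0F) k K.≈ f (ones b) k
    stable b len k k≤n = K.trans
      (K.reflexive (≡.cong (λ c → path-count c (replicate (n ℕ.* length a) 0F) k) (≡.sym (++-identityʳ b))))
      (path-count-stable (n ℕ.* length a) k b 0
        (ℕₚ.≤-reflexive (≡.trans (ℕₚ.+-identityʳ (length b)) len))
        (≡.subst (k ℕ.* length a ℕ.≤_) (≡.sym (ℕₚ.+-identityʳ (n ℕ.* length a))) (ℕₚ.*-monoˡ-≤ (length a) k≤n)))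

  -- Coefficientwise, because the number of zeros on the left side grows with `n`.
  path-count-reversal : ∀ w r n →
    path-count (replicate (suc r) 1F) (w ++ replicate (n ℕ.* suc r) 0F) n K.≈
    (path-count (replicate (suc r) 0F) (reverse w) * f (suc r)) n
  path-count-reversal w r n = K.trans
    (K.reflexive (≡.cong (λ l → path-count 1s (w ++ replicate (n ℕ.* l) 0F) n) (≡.sym (length-replicate (suc r)))))
    (K.trans (path-count-++-0s 1s w n)
      (trans (completed-path-count w r) (*-comm (f (suc r)) (path-count (replicate (suc r) 0F) (reverse w))) .at n))
    where 1s = replicate (suc r) 1F

  jump-vanishes : ∀ b x h → (b ≡ 1F × x ≡ 0F → ⊥) → jump b x h ≡ 0#
  jump-vanishes 0F x  h ¬p = ≡.refl
  jump-vanishes 1F 1F h ¬p = ≡.refl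
  jump-vanishes 1F 0F h ¬p = contradiction (≡.refl , ≡.refl) ¬p

  -- Sums of weights over placements as path counts.

  total : (List ℤ → K.Carrier) → List (List ℤ) → K.Carrier
  total g iss = foldr K._+_ K.0# (map g iss)

  total-++ : ∀ g iss jss → total g (iss ++ jss) K.≈ total g iss K.+ total g jss
  total-++ g []         jss = K.sym (K.+-identityˡ _)
  total-++ g (is ∷ iss) jss = K.trans (K.+-congˡ (total-++ g iss jss)) (K.sym (K.+-assoc _ _ _))

  total-↭ : ∀ g {iss jss} → iss ↭ jss → total g iss K.≈ total g jss
  total-↭ g p = foldr-commMonoid K.setoid K.+-isCommutativeMonoid (↭⇒↭ₛ′ K.isEquivalence (↭ₚ.map⁺ g p))

  module ScanTotal (r : ℕ) where

    open Ribbons (suc r) using (Addable; add; height; totalHeight; placements)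
    open Scanning r

    weight : BitSequence → List ℤ → K.Carrier
    weight s is = y ^ᴷ totalHeight s is

    total-map-∷ : ∀ s i iss →
      total (weight s) (map (i ∷_) iss) K.≈ y ^ᴷ height s i K.* total (weight (add i s)) iss
    total-map-∷ s i []         = K.sym (K.zeroʳ _)
    total-map-∷ s i (is ∷ iss) = K.trans
      (K.+-cong (^-homo-* y (height s i) (totalHeight (add i s) is)) (total-map-∷ s i iss))
      (K.sym (K.distribˡ _ _ _))

    -- The two branches of `scan` are the two terms of `transfer`: without a ribbon the window
    -- slides over `s i`; with one it slides over a 1, while the unread bits are the same.
    total-scan : ∀ s i m n →
      total (weight s) (scan s i m n) K.≈ path-count (window s i) (ahead s i m) n
    total-scan s i m       zero    = K.trans (K.+-identityʳ _) (K.sym (path-count-constant-term (ahead s i m) (window s i)))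
    -- No position is left, and coefficient `suc n` of the constant final weight is zero.
    total-scan s i zero    (suc n) = K.refl
    total-scan s i (suc m) (suc n) = begin
      total (weight s) (scan s (ℤ.suc i) m (suc n) ++ starting)
        ≈⟨ total-++ (weight s) (scan s (ℤ.suc i) m (suc n)) starting ⟩
      total (weight s) (scan s (ℤ.suc i) m (suc n)) K.+ total (weight s) starting
        ≈⟨ K.+-cong (total-scan s (ℤ.suc i) m (suc n)) (total-starting (addable? s i)) ⟩
      path-count (window s (ℤ.suc i)) u (suc n) K.+ (jump b (s i) (ones a) * path-count (a ∷ʳ 1F) u) (suc n)
        ≡⟨ ≡.cong (λ c → path-count c u (suc n) K.+ (jump b (s i) (ones a) * path-count (a ∷ʳ 1F) u) (suc n)) (window-suc s i) ⟩
      path-count (b ∷ a) (s i ∷ u) (suc n)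
        ≡⟨ ≡.cong₂ (λ c v → path-count c v (suc n)) (window-∷ s i) (ahead-suc s i m) ⟨
      path-count (window s i) (ahead s i (suc m)) (suc n) ∎
      where
      open SetoidReasoning K.setoid
      a : List Bit
      a = window-tail s i
      b : Bit
      b = s (i ℤ.- + suc r)
      u : List Bit
      u = ahead s (ℤ.suc i) m
      starting : List (List ℤ)
      starting = startingAt (addable? s i) i (scan (add i s) (ℤ.suc i) m n)
      after : total (weight (add i s)) (scan (add i s) (ℤ.suc i) m n) K.≈ path-count (a ∷ʳ 1F) u n
      after = K.trans (total-scan (add i s) (ℤ.suc i) m n)
        (K.reflexive (≡.cong₂ (λ c v → path-count c v n) (window-add s i) (ahead-add s i m)))
      total-starting : (d : Dec (Addable s i)) →
        total (weight s) (startingAt d i (scan (add i s) (ℤ.suc i) m n)) K.≈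
        (jump b (s i) (ones a) * path-count (a ∷ʳ 1F) u) (suc n)
      total-starting (yes (b≡1 , x≡0)) = begin
        total (weight s) (map (i ∷_) (scan (add i s) (ℤ.suc i) m n))
          ≈⟨ total-map-∷ s i (scan (add i s) (ℤ.suc i) m n) ⟩
        y ^ᴷ height s i K.* total (weight (add i s)) (scan (add i s) (ℤ.suc i) m n)
          ≈⟨ K.*-cong (K.reflexive (≡.cong (y ^ᴷ_) (height-window-tail s i))) after ⟩
        y ^ᴷ ones a K.* path-count (a ∷ʳ 1F) u n
          ≈⟨ wt-*-suc (ones a) (path-count (a ∷ʳ 1F) u) n ⟨
        (wt (ones a) * path-count (a ∷ʳ 1F) u) (suc n)
          ≡⟨ ≡.cong₂ (λ b x → (jump b x (ones a) * path-count (a ∷ʳ 1F) u) (suc n)) b≡1 x≡0 ⟨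
        (jump b (s i) (ones a) * path-count (a ∷ʳ 1F) u) (suc n) ∎
      total-starting (no ¬p) = K.sym
        (*-vanishesˡ (path-count (a ∷ʳ 1F) u) (jump-vanishes b (s i) (ones a) ¬p) .at (suc n))

    -- The positions enumerated by `placements` exceed the length of `w` by `n * suc r`, hence that
    -- many copies of `c`.
    total-placements : ∀ b c w n →
      total (weight (extend b c w)) (placements b c w n) K.≈
      path-count (replicate (suc r) b) (w ++ replicate (n ℕ.* suc r) c) n
    total-placements b c w n = K.trans
      (total-↭ (weight (extend b c w)) (placements-↭-scan b c w n))
      (K.trans (total-scan (extend b c w) (+ 0) (n ℕ.* suc r ℕ.+ length w) n)
        (K.reflexive (≡.cong₂ (λ a u → path-count a u n) (window-extend b c w)
          (≡.trans (≡.cong (ahead (extend b c w) (+ 0)) (ℕₚ.+-comm (n ℕ.* suc r) (length w)))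
                   (applyUpTo-extend b c w (n ℕ.* suc r))))))

    -- Trailing ones admit no ribbon, so the same word serves for every coefficient.
    path-count-placements : ∀ w →
      (λ n → total (weight (extend 0F 1F w)) (placements 0F 1F w n)) ≈ path-count (replicate (suc r) 0F) w
    path-count-placements w .at n = K.trans (total-placements 0F 1F w n)
      (path-count-++-1s w (n ℕ.* suc r) (replicate (suc r) 0F) .at n)

  -- `R` with an arbitrary coefficient ring and element `y`, which keeps integer polynomials out of
  -- the argument.
  placement-series : ℕ → Bit → Bit → List Bit → Carrier
  placement-series r b c w n =
    total (λ is → y ^ᴷ Ribbons.totalHeight r (extend b c w) is) (Ribbons.placements r b c w n)

  placement-series-reversal : ∀ r .{{_ : NonZero r}} w →
    placement-series r 1F 0F w ≈ placement-series r 0F 1F (reverse w) * f r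
  placement-series-reversal (suc r) w .at n = K.trans (total-placements 1F 0F w n)
    (K.trans (path-count-reversal w r n) (*-congʳ {f (suc r)} (sym (path-count-placements (reverse w))) .at n))
    where open ScanTotal r

-- Specialisation to integer polynomials in `Y`.

open CommutativeRing ℤ[Y][[X]]
open SeriesPaths ℤ[Y] Y using (f; placement-series; placement-series-reversal)

f≡∏ : ∀ r → f r ≡ ∏ (λ (h : Fin r) → (1# - X * constant (Y ^ toℕ h)) ⁻¹)
f≡∏ r = ≡.refl

placement-series≡R₁₀ : ∀ r w → placement-series r 1F 0F w ≡ R 1F 0F w r
placement-series≡R₁₀ r w = ≡.refl

placement-series≡R₀₁ : ∀ r w → placement-series r 0F 1F (reverse w) ≡ R 0F 1F (reverse w) r
placement-series≡R₀₁ r w = ≡.refl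

-- The definitional equalities above enter as hypotheses, because comparing
-- the products directly would unfold them down to integer coefficients.
substitute : ∀ r w (s t p : Carrier) → s ≡ R 1F 0F w r → t ≡ R 0F 1F (reverse w) r →
  p ≡ ∏ (λ (h : Fin r) → (1# - X * constant (Y ^ toℕ h)) ⁻¹) → s ≈ t * p →
  R 1F 0F w r ≈ R 0F 1F (reverse w) r * ∏ (λ (h : Fin r) → (1# - X * constant (Y ^ toℕ h)) ⁻¹)
substitute r w _ _ _ ≡.refl ≡.refl ≡.refl s≈t*p = s≈t*p

claim1p1p3 : (r : ℕ) .{{_ : NonZero r}} (w : List Bit) →
    R 1F 0F w r ≈ R 0F 1F (reverse w) r * ∏ (λ (h : Fin r) → (1# - X * constant (Y ^ toℕ h)) ⁻¹)
claim1p1p3 r w = substitute r w _ _ _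
  (placement-series≡R₁₀ r w) (placement-series≡R₀₁ r w) (f≡∏ r) (placement-series-reversal r w)
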